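{- For every $n \in \mathbb{N}$ there is a constant $c_n$ such that every tournament $T$ that contains neither $A_n$ nor $D_n$ as a subtournament satisfies $\overrightarrow{\omega}(T) \leq c_n$.
   Context: A tournament is a finite directed graph with exactly one arc between each pair of distinct vertices. For a total ordering $<$ of $V(T)$, the backedge graph $B(T,<)$ is the graph on $V(T)$ with an edge $uv$ for every pair $u<v$ with $vu \in A(T)$. The clique number of a tournament is $\overrightarrow{\omega}(T)=\min_{<}\omega(B(T,<))$, the minimum over all total orderings of $V(T)$ of the (usual) clique number of the backedge graph. A tournament contains $H$ if some induced subtournament is isomorphic to $H$. For disjoint vertex sets $X,Y$, $X \Rightarrow Y$ means $xy\in A(T)$ for all $x\in X$, $y \in Y$. The tournament $A_1$ is a single vertex; for $n\ge 2$, $A_n$ consists of vertex-disjoint tournaments $T_1,\dots,T_{n-1}$, each isomorphic to $A_{n-1}$, and further vertices $v_1,\dots,v_n$, with: $A_n[V(T_i)]=T_i$; $v_j\Rightarrow v_i$ whenever $i<j$; $V(T_i)\Rightarrow V(T_j)$ whenever $i<j$; $v_i\Rightarrow V(T_j)$ whenever $i\le j$; and $V(T_j)\Rightarrow v_i$ whenever $i>j$. The tournament $D_1$ is a single vertex, and $D_n$ is obtained from two disjoint copies $T_1,T_2$ of $D_{n-1}$ and one further vertex $w$ with $V(T_1)\Rightarrow V(T_2)$, $V(T_2)\Rightarrow w$, $w \Rightarrow V(T_1)$. -}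

module Defs where

open import Data.Nat using (ℕ; zero; suc; _≤_; _<_; _<ᵇ_; _≤ᵇ_; _≡ᵇ_)
open import Data.Bool using (Bool; true; false; not; if_then_else_; _∧_)
open import Data.Fin using (Fin; toℕ)
open import Data.Fin.Permutation using (Permutation′; _⟨$⟩ʳ_)
open import Data.Unit using (⊤; tt)
open import Data.Product using (_×_; _,_; ∃)
open import Data.Sum using (_⊎_; inj₁; inj₂)
open import Relation.Binary.PropositionalEquality using (_≡_; _≢_)
open import Relation.Nullary using (¬_)
open import Function.Definitions using (Injective)

record Tournament (V : Set) : Set where
  field
    arc    : V → V → Bool
    irrefl : ∀ v → arc v v ≡ false
    tourn  : ∀ u v → u ≢ v → arc u v ≡ not (arc v u)
open Tournament public

FinTournament : ℕ → Set
FinTournament m = Tournament (Fin m)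

Contains : {V : Set} → Tournament V → {W : Set} → (W → W → Bool) → Set
Contains {V} T {W} h =
  ∃ λ (f : W → V) → Injective _≡_ _≡_ f × (∀ x y → arc T (f x) (f y) ≡ h x y)

-- A_n.  AV k is the vertex type of A_(k+1), A-arc k its arc relation.
-- A_(k+2): copies T_0..T_k of A_(k+1) (inj₁ (i , x)) and vertices
-- v_0..v_(k+1) (inj₂ i)  (0-indexed versions of T_1..T_(k+1), v_1..v_(k+2)).

AV : ℕ → Set
AV zero    = ⊤
AV (suc k) = (Fin (suc k) × AV k) ⊎ Fin (suc (suc k))

A-arc : (k : ℕ) → AV k → AV k → Bool
A-arc zero    _ _ = false
A-arc (suc k) (inj₁ (i , x)) (inj₁ (j , y)) =
  if toℕ i ≡ᵇ toℕ j then A-arc k x y else (toℕ i <ᵇ toℕ j)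
A-arc (suc k) (inj₂ a) (inj₂ b) = toℕ b <ᵇ toℕ a
A-arc (suc k) (inj₂ i) (inj₁ (j , _)) = toℕ i ≤ᵇ toℕ j
A-arc (suc k) (inj₁ (j , _)) (inj₂ i) = toℕ j <ᵇ toℕ i

-- D_n.  DV k is the vertex type of D_(k+1), D-arc k its arc relation.
-- D_(k+2): copies T_1 (inj₁ (false , x)), T_2 (inj₁ (true , x)) of D_(k+1)
-- and the vertex w (inj₂ tt);  V(T_1) ⇒ V(T_2) ⇒ w ⇒ V(T_1).

DV : ℕ → Set
DV zero    = ⊤
DV (suc k) = (Bool × DV k) ⊎ ⊤

D-arc : (k : ℕ) → DV k → DV k → Bool
D-arc zero _ _ = false
D-arc (suc k) (inj₁ (false , x)) (inj₁ (false , y)) = D-arc k x y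
D-arc (suc k) (inj₁ (true  , x)) (inj₁ (true  , y)) = D-arc k x y
D-arc (suc k) (inj₁ (false , _)) (inj₁ (true  , _)) = true
D-arc (suc k) (inj₁ (true  , _)) (inj₁ (false , _)) = false
D-arc (suc k) (inj₁ (true  , _)) (inj₂ _) = true
D-arc (suc k) (inj₁ (false , _)) (inj₂ _) = false
D-arc (suc k) (inj₂ _) (inj₁ (false , _)) = true
D-arc (suc k) (inj₂ _) (inj₁ (true  , _)) = false
D-arc (suc k) (inj₂ _) (inj₂ _) = false

-- Total orderings of Fin m are given by a permutation π (position map):
-- u < v  iff  π u < π v.
Ordering : ℕ → Set
Ordering m = Permutation′ m

_≺[_]_ : {m : ℕ} → Fin m → Ordering m → Fin m → Set
u ≺[ π ] v = toℕ (π ⟨$⟩ʳ u) < toℕ (π ⟨$⟩ʳ v)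

BackEdge : {m : ℕ} → FinTournament m → Ordering m → Fin m → Fin m → Set
BackEdge T π u v =
  (u ≺[ π ] v × arc T v u ≡ true) ⊎ (v ≺[ π ] u × arc T u v ≡ true)

Clique : {m : ℕ} → FinTournament m → Ordering m → ℕ → Set
Clique {m} T π k =
  ∃ λ (g : Fin k → Fin m) → Injective _≡_ _≡_ g × (∀ i j → i ≢ j → BackEdge T π (g i) (g j))

ωB≤ : {m : ℕ} → FinTournament m → Ordering m → ℕ → Set
ωB≤ T π c = ∀ k → Clique T π k → k ≤ c

-- clique number of T is ≤ c : min over orderings of ω(B(T,<)) is ≤ c,
-- i.e. some ordering has ω(B(T,<)) ≤ c.
cliqueNumber≤ : {m : ℕ} → FinTournament m → ℕ → Set
cliqueNumber≤ {m} T c = ∃ λ (π : Ordering m) → ωB≤ T π c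

{-# OPTIONS --safe #-}
module Submission where

-- Induct on (a , b), bounding the clique number of tournaments without A_a and D_b.  A set of
-- large clique number then contains a "certificate": a bounded set holding A_{a-1} and D_{b-1}.
-- No vertex w and certificates P, Q satisfy P ⇒ Q ⇒ w ⇒ P (this is D_b), and certificates cannot
-- be interleaved a times with a back-clique (this is A_a).
--
-- Domination.  Suppose X needs many vertices to dominate it, let S be a large part of a minimum
-- dominating set, and let P be a certificate with P ⇒ S.  For s in S the set of out-neighbours y
-- of s with y ⇒ P has no certificate, hence is dominated by a few of its own vertices z.
-- Repeating with a new certificate in front of all vertices used so far gives
-- s → z₁ → z₂ → ⋯ interleaved with certificates, hence A_a.  So every set is dominated (and,
-- dually, absorbed) by boundedly many of its vertices.
--
-- Pure pairs.  Among many rich sets between the vertices of a back-clique, either certificates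
-- can be chosen completely joined to each other, which gives A_a, or generic vertices of the
-- sets split each other as we please, and D_b embeds greedily.  It follows that the
-- differences {x : y → x → y′} and {x : y′ → x → y} are never both rich, so out-neighbourhoods
-- form a chain up to bounded error.
--
-- Order.  Sort the vertices along this chain.  Consecutive vertices with nearly the same
-- out-neighbourhood form blocks of bounded clique number by domination, and a long back-clique
-- meeting many blocks would again be interleaved with rich sets.
--
-- Everything is proved in the double negation monad; the final order is found by finite search.

open import Defs
open import Level using (Level)
open import Data.Nat hiding (_≟_; Ordering)
open import Data.Nat.Properties hiding (_≟_)
open import Algebra.Properties.CommutativeSemigroup +-commutativeSemigroup using (interchange)
open import Data.Bool using (Bool; true; false; not)
import Data.Bool.Properties as Bool
open import Data.Unit using (⊤; tt)
open import Data.Empty using (⊥; ⊥-elim)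
open import Data.Product using (Σ; ∃; ∃₂; _×_; _,_; proj₁; proj₂)
open import Data.Sum as Sum using (_⊎_; inj₁; inj₂)
open import Data.Fin as Fin using (Fin; zero; suc; toℕ; inject₁; opposite)
import Data.Fin.Properties as Fin
open import Data.Fin.Permutation using (permutation)
open import Data.List using (List; []; _∷_; _++_; length; reverse; filter; map; concat; take; drop; lookup; allFin; cartesianProduct)
open import Data.List.Properties
open import Data.List.Relation.Unary.All as All using (All; []; _∷_)
import Data.List.Relation.Unary.All.Properties as AllP
open import Data.List.Relation.Unary.Any as Any using (Any; here; there)
import Data.List.Relation.Unary.Any.Properties as AnyP
open import Data.List.Relation.Unary.AllPairs as AllPairs using (AllPairs; []; _∷_)
import Data.List.Relation.Unary.AllPairs.Properties as AllPairsP
open import Data.List.Relation.Unary.Linked as Linked using (Linked; []; [-]; _∷_)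
open import Data.List.Membership.Propositional using (_∈_; find)
open import Data.List.Membership.Propositional.Properties
open import Data.List.Relation.Binary.Sublist.Propositional using ([]; _∷_; _∷ʳ_; ⊆-refl; ⊆-trans) renaming (_⊆_ to _⊑_)
import Data.List.Relation.Binary.Sublist.Propositional.Properties as Sub
import Data.List.Relation.Binary.Sublist.Heterogeneous as HS
import Data.List.Relation.Binary.Sublist.Heterogeneous.Properties as HSP
open import Relation.Nullary using (¬_; Dec; yes; no)
open import Relation.Nullary.Decidable using (¬¬-excluded-middle; decidable-stable; _×-dec_; _⊎-dec_; map′; ¬?)
open import Relation.Binary.PropositionalEquality using (_≡_; _≢_; refl; sym; trans; cong; cong₂; subst; subst₂)
open import Relation.Binary.Definitions using (DecidableEquality; Decidable; tri<; tri≈; tri>)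
open import Function using (_∘_; id; flip; case_of_)
open import Function.Definitions using (Injective)

private variable
  ℓ₁ ℓ₂ ℓ₃ : Level
  A : Set ℓ₁
  B : Set ℓ₂

-- Double negation and sublists.

infixl 1 _>>=_
_>>=_ : ¬ ¬ A → (A → ¬ ¬ B) → ¬ ¬ B
(m >>= f) k = m λ a → f a k

return : A → ¬ ¬ A
return a k = k a

em : ¬ ¬ Dec A
em = ¬¬-excluded-middle

em-case : (A → ¬ ¬ B) → (¬ A → ¬ ¬ B) → ¬ ¬ B
em-case f g = em >>= λ { (yes a) → f a ; (no ¬a) → g ¬a }

¬¬-All : {P : A → Set ℓ₂} {xs : List A} → All (λ x → ¬ ¬ P x) xs → ¬ ¬ All P xs
¬¬-All []       = return []
¬¬-All (p ∷ ps) = do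
  q ← p
  qs ← ¬¬-All ps
  return (q ∷ qs)

All-resp-⊑ : {P : A → Set ℓ₂} {xs ys : List A} → xs ⊑ ys → All P ys → All P xs
All-resp-⊑ []         []       = []
All-resp-⊑ (y ∷ʳ s)   (p ∷ ps) = All-resp-⊑ s ps
All-resp-⊑ (refl ∷ s) (p ∷ ps) = p ∷ All-resp-⊑ s ps

AllPairs-resp-⊑ : {R : A → A → Set ℓ₂} {xs ys : List A} → xs ⊑ ys → AllPairs R ys → AllPairs R xs
AllPairs-resp-⊑ []         []       = []
AllPairs-resp-⊑ (y ∷ʳ s)   (p ∷ ps) = AllPairs-resp-⊑ s ps
AllPairs-resp-⊑ (refl ∷ s) (p ∷ ps) = All-resp-⊑ s p ∷ AllPairs-resp-⊑ s ps

All-reverse : {P : A → Set ℓ₂} {xs : List A} → All P xs → All P (reverse xs)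
All-reverse ps = All.tabulate λ m → All.lookup ps (AnyP.reverse⁻ m)

AllPairs-reverse : {R : A → A → Set ℓ₂} {xs : List A} → AllPairs R xs → AllPairs (flip R) (reverse xs)
AllPairs-reverse {xs = []} [] = []
AllPairs-reverse {R = R} {xs = x ∷ xs} (p ∷ ps) rewrite unfold-reverse x xs =
  AllPairsP.++⁺ (AllPairs-reverse ps) ([] ∷ []) (All.map (λ r → r ∷ []) (All-reverse p))

AllPairs-++⁻ : {R : A → A → Set ℓ₂} (xs : List A) {ys : List A} → AllPairs R (xs ++ ys) →
  AllPairs R xs × AllPairs R ys × All (λ x → All (R x) ys) xs
AllPairs-++⁻ []       ps       = [] , ps , []
AllPairs-++⁻ (x ∷ xs) (p ∷ ps) with AllPairs-++⁻ xs ps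
... | a , b , c = AllP.++⁻ˡ xs p ∷ a , b , AllP.++⁻ʳ xs p ∷ c

⊑-++⁻ : (xs : List A) {ys zs : List A} → zs ⊑ xs ++ ys →
  ∃₂ λ us vs → zs ≡ us ++ vs × us ⊑ xs × vs ⊑ ys
⊑-++⁻ []       s          = [] , _ , refl , [] , s
⊑-++⁻ (x ∷ xs) (.x ∷ʳ s)  with ⊑-++⁻ xs s
... | us , vs , e , s₁ , s₂ = us , vs , e , x ∷ʳ s₁ , s₂
⊑-++⁻ (x ∷ xs) (refl ∷ s) with ⊑-++⁻ xs s
... | us , vs , refl , s₁ , s₂ = x ∷ us , vs , refl , refl ∷ s₁ , s₂

filter-∈ : {P : A → Set ℓ₂} (xs : List A) → ¬ ¬ (∃ λ ys → ys ⊑ xs × All P ys × (∀ x → x ∈ xs → P x → x ∈ ys))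
filter-∈ [] = return ([] , [] , [] , λ _ ())
filter-∈ {P = P} (x ∷ xs) = do
  ys , s , a , c ← filter-∈ {P = P} xs
  em >>= λ where
    (yes p) → return (x ∷ ys , refl ∷ s , p ∷ a ,
                      λ { _ (here refl) _ → here refl ; z (there m) q → there (c z m q) })
    (no ¬p) → return (ys , x ∷ʳ s , a ,
                      λ { _ (here refl) q → ⊥-elim (¬p q) ; z (there m) q → c z m q })

-- Tournaments, back-cliques and domination.

domNeed : ℕ → ℕ → ℕ → ℕ → ℕ → ℕ
domNeed ℓ c zero    u q = u + c
domNeed ℓ c (suc r) u q = (u + c) ⊔ domNeed ℓ c r (u + (ℓ + q * c)) (q * c)

-- `domNeed ℓ c r u q` is how hard `Y` must be to dominate for `r` more rounds of `tree`, where `u`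
-- bounds the vertices held so far and `q` the number of chains. A round adds one certificate and at
-- most `c` dominators per chain. The start is at most `m` chains of one vertex each.
domBound : ℕ → ℕ → ℕ → ℕ
domBound ℓ c a = domNeed ℓ c a m m ⊔ m
  where m = suc (suc a * ℓ)

record Tourn : Set₁ where
  infix 4 _⟶_
  field
    V        : Set
    _≟_      : DecidableEquality V
    _⟶_      : V → V → Set
    _⟶?_     : Decidable _⟶_
    tri      : ∀ u v → u ≡ v ⊎ u ⟶ v ⊎ v ⟶ u
    asym     : ∀ {u v} → u ⟶ v → v ⟶ u → ⊥
    allV     : List V
    complete : ∀ v → v ∈ allV

op : Tourn → Tourn
op 𝕋 = record
  { V = V ; _≟_ = _≟_ ; _⟶_ = flip _⟶_ ; _⟶?_ = flip _⟶?_
  ; tri = λ u v → Sum.map₂ Sum.swap (tri u v) ; asym = flip asym ; allV = allV ; complete = complete }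
  where open Tourn 𝕋

module Tour (𝕋 : Tourn) where
  open Tourn 𝕋

  _∈?_ : (v : V) (L : List V) → Dec (v ∈ L)
  v ∈? L = Any.any? (v ≟_) L

  Back : V → V → Set
  Back x y = y ⟶ x

  -- Repetitions in the list do no harm: `asym` rules out loops, so a pairwise `Back` sublist has
  -- distinct entries.
  Good : ℕ → List V → Set
  Good k L = ∀ K → K ⊑ L → AllPairs Back K → length K ≤ k

  -- Ω k Y: the clique number of the subtournament on Y is at most k.
  record Ω (k : ℕ) (Y : V → Set ℓ₁) : Set ℓ₁ where
    constructor order
    field
      L     : List V
      good  : Good k L
      cover : ∀ v → Y v → v ∈ L

  Good-⊑ : ∀ {k L L′} → L′ ⊑ L → Good k L → Good k L′
  Good-⊑ s g K s′ = g K (⊆-trans s′ s)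

  Good-++ : ∀ {k l} L {L′} → Good k L → Good l L′ → Good (k + l) (L ++ L′)
  Good-++ {k} {l} L g g′ K s ap with ⊑-++⁻ L s
  ... | us , vs , refl , s₁ , s₂ with AllPairs-++⁻ us ap
  ... | a , b , _ = subst (_≤ k + l) (sym (length-++ us)) (+-mono-≤ (g us s₁ a) (g′ vs s₂ b))

  Good-filter : ∀ {k x L} → Good (suc k) (x ∷ L) → Good k (filter (_⟶? x) L)
  Good-filter {k} {x} {L} g K s ap =
    s≤s⁻¹ (g (x ∷ K) (refl ∷ ⊆-trans s (Sub.filter-⊆ (_⟶? x) L))
             (All-resp-⊑ s (AllP.all-filter (_⟶? x) L) ∷ ap))

  Ω-mono : ∀ {k} {Y : V → Set ℓ₁} {Z : V → Set ℓ₂} → (∀ v → Z v → Y v) → Ω k Y → Ω k Z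
  Ω-mono i (order L g c) = order L g λ v z → c v (i v z)

  Ω-≤ : ∀ {k l} {Y : V → Set ℓ₁} → k ≤ l → Ω k Y → Ω l Y
  Ω-≤ le (order L g c) = order L (λ K s a → ≤-trans (g K s a) le) c

  -- Membership in a list is decidable, so a splitting known only up to double negation is enough.
  Ω-∪ : ∀ {k l} {Y : V → Set ℓ₁} {Z : V → Set ℓ₂} {W : V → Set ℓ₃} → (∀ v → W v → ¬ ¬ (Y v ⊎ Z v)) → Ω k Y → Ω l Z → Ω (k + l) W
  Ω-∪ i (order L g c) (order L′ g′ c′) = order (L ++ L′) (Good-++ L g g′) λ v w →
    decidable-stable (v ∈? (L ++ L′)) (do
      inj₁ y ← i v w where inj₂ z → return (∈-++⁺ʳ L (c′ v z))
      return (∈-++⁺ˡ (c v y)))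

  Ω-∅ : ∀ {k} {Y : V → Set ℓ₁} → (∀ v → ¬ Y v) → Ω k Y
  Ω-∅ e = order [] (λ { [] _ _ → z≤n }) λ v y → ⊥-elim (e v y)

  Ω-one : {Y : V → Set ℓ₁} (x : V) → (∀ v → Y v → v ≡ x) → Ω 1 Y
  Ω-one x e = order (x ∷ []) (λ { [] _ _ → z≤n ; (_ ∷ []) _ _ → s≤s z≤n ; (_ ∷ _ ∷ _) (_ ∷ ()) _ ; (_ ∷ _ ∷ _) (_ ∷ʳ ()) _ })
              λ v y → here (e v y)

  Ω-list : ∀ {A : Set ℓ₁} {t} {P : A → V → Set ℓ₂} (zs : List A) → All (λ z → Ω t (P z)) zs →
    Ω (length zs * t) (λ v → Any (λ z → P z v) zs)
  Ω-list []       []       = Ω-∅ λ _ ()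
  Ω-list (z ∷ zs) (p ∷ ps) = Ω-∪ (λ { _ (here q) → return (inj₁ q) ; _ (there q) → return (inj₂ q) }) p (Ω-list zs ps)

  domBy : List V → V → Set
  domBy Z y = Any (λ z → y ≡ z ⊎ z ⟶ y) Z

  domBy? : ∀ Z y → Dec (domBy Z y)
  domBy? Z y = Any.any? (λ z → (y ≟ z) ⊎-dec (z ⟶? y)) Z

  Dom : ℕ → (V → Set) → Set
  Dom k Y = ∃ λ Z → length Z ≤ k × All Y Z × (∀ y → Y y → domBy Z y)

  undominated : ∀ {Z y} → ¬ domBy Z y → All (y ⟶_) Z
  undominated {[]}    n = []
  undominated {z ∷ Z} {y} n with tri y z
  ... | inj₁ e        = ⊥-elim (n (here (inj₁ e)))
  ... | inj₂ (inj₁ a) = a ∷ undominated (n ∘ there)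
  ... | inj₂ (inj₂ a) = ⊥-elim (n (here (inj₂ a)))

  Dom-≤ : ∀ {k l Y} → k ≤ l → Dom k Y → Dom l Y
  Dom-≤ le (Z , p , q) = Z , ≤-trans p le , q

  -- The first vertex of a good order dominates everything but its back-neighbours.
  Ω⇒Dom : ∀ {k} {Y : V → Set} → Ω k Y → ¬ ¬ Dom k Y
  Ω⇒Dom (order L g c) = go _ L _ g c
    where
    go : ∀ k L (Y : V → Set) → Good k L → (∀ v → Y v → v ∈ L) → ¬ ¬ Dom k Y
    go k [] Y g c = return ([] , z≤n , [] , λ y p → case c y p of λ ())
    go zero (x ∷ L) Y g c with g (x ∷ []) (refl ∷ Sub.[]⊆-universal L) ([] ∷ [])
    ... | ()
    go (suc k) (x ∷ L) Y g c = em-case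
      (λ p → go k (filter (_⟶? x) L) (λ v → Y v × v ⟶ x) (Good-filter g)
                (λ { v (q , r) → case c v q of λ { (here refl) → ⊥-elim (asym r r)
                                                 ; (there m) → ∈-filter⁺ (_⟶? x) m r } })
        >>= λ { (Z , l , a , d) →
        return (x ∷ Z , s≤s l , p ∷ All.map proj₁ a , λ y q → case tri y x of λ
          { (inj₁ e) → here (inj₁ e)
          ; (inj₂ (inj₁ r)) → there (d y (q , r))
          ; (inj₂ (inj₂ r)) → here (inj₂ r) }) })
      (λ ¬p → go (suc k) L Y (Good-⊑ (x ∷ʳ ⊆-refl) g)
                 λ v p → case c v p of λ { (here refl) → ⊥-elim (¬p p) ; (there m) → m })

  _⇒_ : List V → List V → Set
  xs ⇒ ys = All (λ x → All (x ⟶_) ys) xs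

  Pair : Set
  Pair = V × List V

  -- A list (v₁ , xs₁) ∷ (v₂ , xs₂) ∷ ⋯ of Full pairs with vᵢ ⇒ xsᵢ is the pattern of A_n read from left
  -- to right, with certificates in place of the copies of A_{n-1}.
  Full : Pair → Pair → Set
  Full (v , xs) (v′ , xs′) = v′ ⟶ v × All (v ⟶_) xs′ × All (_⟶ v′) xs × xs ⇒ xs′

  -- Bounded domination, for a tournament and its opposite alike.

  record DomData : Set₁ where
    field
      X         : V → Set
      Cert      : List V → Set
      ℓ c a     : ℕ
      cert-len  : ∀ {xs} → Cert xs → length xs ≤ ℓ
      cert-ne   : ∀ {xs} → Cert xs → ∃ (_∈ xs)
      cert-free : ∀ (Y : V → Set) → (∀ v → Y v → X v) → ¬ (∃ λ xs → Cert xs × All Y xs) → ¬ ¬ Dom c Y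
      noTriangle        : ∀ w {xs ys} → X w → Cert xs → Cert ys → All (w ⟶_) xs → All (_⟶ w) ys → xs ⇒ ys → ⊥
      noChain        : ∀ ps → All (λ p → X (proj₁ p) × Cert (proj₂ p) × All (proj₁ p ⟶_) (proj₂ p)) ps →
                  AllPairs Full ps → length ps ≡ a → ⊥

  module DomLemma (𝔻 : DomData) (Y : V → Set) (Y⊆X : ∀ v → Y v → DomData.X 𝔻 v) where
    open DomData 𝔻

    Own : Pair → Set
    Own (v , xs) = X v × Cert xs × All (v ⟶_) xs

    -- A root followed by the pairs found so far, newest first, which is the left-to-right order of
    -- `Full`.
    Chain : Set
    Chain = V × List Pair

    verts : Chain → List V
    verts (s , ps) = s ∷ map proj₁ ps

    record OK (used E : List V) (n : ℕ) (ch : Chain) : Set where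
      constructor ok
      field
        base   : X (proj₁ ch)
        v∈     : All (_∈ used) (verts ch)
        x∈     : All (λ p → All (_∈ E) (proj₂ p)) (proj₂ ch)
        own    : All Own (proj₂ ch)
        full   : AllPairs Full (proj₂ ch)
        len    : length (proj₂ ch) ≡ n

    -- The invariant of the rounds. At the end `star` supplies a vertex to which it applies, and
    -- hence a chain of full length.
    Cover : List V → List V → List V → List Chain → Set
    Cover S used E cs = ∀ y → Y y → domBy S y → All (y ⟶_) E →
      y ∈ used ⊎ Any (λ ch → All (_⟶ y) (verts ch)) cs

    -- The vertices that `us` fails to dominate beat all of `us`. If they held no certificate, `c`
    -- of them together with `us` would dominate `Y`.
    getCert : ∀ us → All Y us → ∀ {k} → length us + c ≤ k → ¬ Dom k Y →
      ¬ ¬ (∃ λ A → Cert A × All Y A × A ⇒ us)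
    getCert us us⊆ {k} le nd nc = cert-free (λ v → Y v × All (v ⟶_) us) (λ v p → Y⊆X v (proj₁ p))
        (λ { (A , cA , q) → nc (A , cA , All.map proj₁ q , All.map proj₂ q) })
        λ { (Z , lZ , Z⊆ , d) → nd (us ++ Z ,
              ≤-trans (≤-reflexive (length-++ us)) (≤-trans (+-monoʳ-≤ (length us) lZ) le) ,
              AllP.++⁺ us⊆ (All.map proj₁ Z⊆) ,
              λ y Yy → case domBy? us y of λ
                { (yes p) → AnyP.++⁺ˡ p
                ; (no ¬p) → AnyP.++⁺ʳ us (d y (Yy , undominated ¬p)) }) }

    module _ (S : List V) (e : ℕ)
      -- What minimality of the dominating set provides: no small `E` can take over the work of `S`.
      (star : ∀ E → All Y E → length E ≤ e → ¬ ¬ (∃ λ y → Y y × domBy S y × ¬ domBy E y)) where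

      module Step (used E : List V) (n : ℕ) (A : List V) (cA : Cert A) (A⊆ : All Y A)
                  (A⇒ : A ⇒ (used ++ E)) where

        Out : Chain → V → Set
        Out ch y = Y y × All (y ⟶_) (A ++ E) × All (_⟶ y) (verts ch)

        -- A certificate inside `Out ch` would close a triangle with `A` and the root `s`.
        domOut : ∀ ch → OK used E n ch → ¬ ¬ Dom c (Out ch)
        domOut ch@(s , ps) o = cert-free (Out ch) (λ v p → Y⊆X v (proj₁ p)) λ { (ys , cy , q) →
          noTriangle s (OK.base o) cy cA (All.map (λ p → All.head (proj₂ (proj₂ p))) q)
             (All.map (λ a → All.lookup a (∈-++⁺ˡ (All.head (OK.v∈ o)))) A⇒)
             (All.map (λ p → AllP.++⁻ˡ A (proj₁ (proj₂ p))) q) }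

        newV : ∀ cs → All (λ ch → Dom c (Out ch)) cs → List V
        newV []       []       = []
        newV (ch ∷ cs) (d ∷ ds) = proj₁ d ++ newV cs ds

        newC : ∀ cs → All (λ ch → Dom c (Out ch)) cs → List Chain
        newC []       []       = []
        newC (ch ∷ cs) (d ∷ ds) = map (λ z → proj₁ ch , (z , A) ∷ proj₂ ch) (proj₁ d) ++ newC cs ds

        newV-len : ∀ cs ds → length (newV cs ds) ≤ length cs * c
        newV-len [] [] = z≤n
        newV-len (ch ∷ cs) (d ∷ ds) = ≤-trans (≤-reflexive (length-++ (proj₁ d)))
          (+-mono-≤ (proj₁ (proj₂ d)) (newV-len cs ds))

        newC-len : ∀ cs ds → length (newC cs ds) ≡ length (newV cs ds)
        newC-len [] [] = refl
        newC-len (ch ∷ cs) (d ∷ ds) = trans (length-++ (map _ (proj₁ d)))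
          (trans (cong₂ _+_ (length-map _ (proj₁ d)) (newC-len cs ds)) (sym (length-++ (proj₁ d))))

        newV-Y : ∀ cs ds → All Y (newV cs ds)
        newV-Y [] [] = []
        newV-Y (ch ∷ cs) (d ∷ ds) = AllP.++⁺ (All.map proj₁ (proj₁ (proj₂ (proj₂ d)))) (newV-Y cs ds)

        -- The new pair goes to the front. The four parts of `Full` come from the old chain hitting
        -- `z`, from `z` beating `E`, and twice from `A` beating `used ++ E`.
        newOK : ∀ {W} cs ds → All (OK used E n) cs → (∀ {v} → v ∈ used → v ∈ W) →
          (∀ {v} → v ∈ newV cs ds → v ∈ W) → All (OK W (A ++ E) (suc n)) (newC cs ds)
        newOK [] [] [] _ _ = []
        newOK (ch@(s , ps) ∷ cs) (d ∷ ds) (o ∷ os) i j = AllP.++⁺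
          (AllP.map⁺ (All.tabulate λ {z} z∈ → let (Yz , z⇒ , hit) = All.lookup (proj₁ (proj₂ (proj₂ d))) z∈ in
            ok (OK.base o)
               (i (All.head (OK.v∈ o)) ∷ j (∈-++⁺ˡ z∈) ∷ All.map i (All.tail (OK.v∈ o)))
               (All.tabulate ∈-++⁺ˡ ∷ All.map (All.map (∈-++⁺ʳ A)) (OK.x∈ o))
               ((Y⊆X z Yz , cA , AllP.++⁻ˡ A z⇒) ∷ OK.own o)
               (All.tabulate (λ {p} p∈ →
                   All.lookup (All.tail hit) (∈-map⁺ proj₁ p∈) ,
                   All.map (λ m → All.lookup z⇒ (∈-++⁺ʳ A m)) (All.lookup (OK.x∈ o) p∈) ,
                   All.map (λ q → All.lookup q (∈-++⁺ˡ (All.lookup (All.tail (OK.v∈ o)) (∈-map⁺ proj₁ p∈)))) A⇒ ,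
                   All.map (λ q → All.map (λ m → All.lookup q (∈-++⁺ʳ used m)) (All.lookup (OK.x∈ o) p∈)) A⇒)
                 ∷ OK.full o)
               (cong suc (OK.len o))))
          (newOK cs ds os i (j ∘ ∈-++⁺ʳ (proj₁ d)))

        -- Such a `y` lies in `Out ch`, so it is one of the chosen dominators or is beaten by one,
        -- and that dominator extends the chain.
        newCover : ∀ cs ds y → Y y → All (y ⟶_) (A ++ E) → Any (λ ch → All (_⟶ y) (verts ch)) cs →
          y ∈ newV cs ds ⊎ Any (λ ch → All (_⟶ y) (verts ch)) (newC cs ds)
        newCover (ch ∷ cs) (d@(Z , _ , _ , dom) ∷ ds) y Yy y⇒ (here hit) = go Z (dom y (Yy , y⇒ , hit))
          where
          go : ∀ Z → domBy Z y → y ∈ Z ++ newV cs ds ⊎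
            Any (λ ch → All (_⟶ y) (verts ch)) (map (λ z → proj₁ ch , (z , A) ∷ proj₂ ch) Z ++ newC cs ds)
          go (z ∷ Z) (here (inj₁ e)) = inj₁ (here e)
          go (z ∷ Z) (here (inj₂ r)) = inj₂ (here (All.head hit ∷ r ∷ All.tail hit))
          go (z ∷ Z) (there m)       = Sum.map there there (go Z m)
        newCover (ch ∷ cs) (d ∷ ds) y Yy y⇒ (there m) =
          Sum.map (∈-++⁺ʳ (proj₁ d)) (AnyP.++⁺ʳ _) (newCover cs ds y Yy y⇒ m)

      -- Here `n` rounds are done and `r` remain. The budget `suc r * ℓ` leaves room for one
      -- certificate beyond the `a` that enter the chains.
      tree : ∀ r n u q used E cs → r + n ≡ a → length used + length E ≤ u → length cs ≤ q →
        All Y used → All Y E → All (OK used E n) cs → Cover S used E cs →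
        suc r * ℓ + length E ≤ e → ¬ Dom (domNeed ℓ c r u q) Y → ⊥
      tree r n u q used E cs rn lu lq used⊆ E⊆ oks cov le nd =
        getCert (used ++ E) (AllP.++⁺ used⊆ E⊆) (+-monoˡ-≤ c (≤-trans (≤-reflexive (length-++ used)) lu))
                (nd ∘ Dom-≤ (first r)) λ { (A , cA , A⊆ , A⇒) → next r rn le nd A cA A⊆ A⇒ }
        where
        first : ∀ r → u + c ≤ domNeed ℓ c r u q
        first zero    = ≤-refl
        first (suc r) = m≤m⊔n _ _
        next : ∀ r → r + n ≡ a → suc r * ℓ + length E ≤ e → ¬ Dom (domNeed ℓ c r u q) Y → ∀ A → Cert A → All Y A → A ⇒ (used ++ E) → ⊥
        next zero refl le nd A cA A⊆ A⇒ =
          -- The extra certificate `A` beats every used vertex while `y` beats `A`, so `y` is new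
          -- and is covered by a chain of length `a`.
          star (A ++ E) (AllP.++⁺ A⊆ E⊆)
            (≤-trans (≤-reflexive (length-++ A)) (≤-trans (+-monoˡ-≤ (length E) (≤-trans (cert-len cA) (m≤m+n ℓ _))) le))
            λ { (y , Yy , dS , nE) → let y⇒ = undominated nE in
              case cov y Yy dS (AllP.++⁻ʳ A y⇒) of λ
                { (inj₁ y∈) → let (x , x∈) = cert-ne cA in
                    asym (All.lookup y⇒ (∈-++⁺ˡ x∈)) (All.lookup (All.lookup A⇒ x∈) (∈-++⁺ˡ y∈))
                ; (inj₂ m) → let (ch , ch∈ , _) = find m ; o = All.lookup oks ch∈ in
                    noChain (proj₂ ch) (OK.own o) (OK.full o) (OK.len o) } }
        next (suc r) rn le nd A cA A⊆ A⇒ = ¬¬-All (All.map (λ {ch} → domOut ch) oks) λ ds →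
          tree r (suc n) _ _ (used ++ newV cs ds) (A ++ E) (newC cs ds) (trans (+-suc r n) rn)
            (begin
              length (used ++ newV cs ds) + length (A ++ E)
                ≡⟨ cong₂ _+_ (length-++ used) (length-++ A) ⟩
              (length used + length (newV cs ds)) + (length A + length E)
                ≡⟨ lem (length used) (length (newV cs ds)) (length A) (length E) ⟩
              (length used + length E) + (length A + length (newV cs ds))
                ≤⟨ +-mono-≤ lu (+-mono-≤ (cert-len cA) (≤-trans (newV-len cs ds) (*-monoˡ-≤ c lq))) ⟩
              u + (ℓ + q * c) ∎)
            (≤-trans (≤-reflexive (newC-len cs ds)) (≤-trans (newV-len cs ds) (*-monoˡ-≤ c lq)))
            (AllP.++⁺ used⊆ (newV-Y cs ds)) (AllP.++⁺ A⊆ E⊆)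
            (newOK cs ds oks ∈-++⁺ˡ (∈-++⁺ʳ used))
            (λ y Yy dS y⇒ → case cov y Yy dS (AllP.++⁻ʳ A y⇒) of λ
              { (inj₁ m) → inj₁ (∈-++⁺ˡ m)
              ; (inj₂ m) → Sum.map₁ (∈-++⁺ʳ used) (newCover cs ds y Yy y⇒ m) })
            (begin
              suc r * ℓ + length (A ++ E) ≡⟨ cong (suc r * ℓ +_) (length-++ A) ⟩
              suc r * ℓ + (length A + length E) ≡⟨ sym (+-assoc (suc r * ℓ) _ _) ⟩
              suc r * ℓ + length A + length E
                ≤⟨ +-monoˡ-≤ (length E) (≤-trans (+-monoʳ-≤ (suc r * ℓ) (cert-len cA)) (≤-reflexive (+-comm (suc r * ℓ) ℓ))) ⟩
              ℓ + suc r * ℓ + length E ≤⟨ le ⟩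
              e ∎)
            (nd ∘ Dom-≤ (m≤n⊔m (u + c) _))
          where
          open Step used E n A cA A⊆ A⇒
          open ≤-Reasoning
          lem : ∀ a b c d → (a + b) + (c + d) ≡ (a + d) + (c + b)
          lem a b c d = trans (cong ((a + b) +_) (+-comm c d)) (trans (interchange a b d c) (cong ((a + d) +_) (+-comm b c)))

    Dom-all : ¬ ¬ Dom (length allV) Y
    Dom-all = do
      ys , s , a , c ← filter-∈ {P = Y} allV
      return (ys , Sub.length-mono-≤ s , a , λ y Yy → Any.map inj₁ (c y (complete y) Yy))

    minDom : ∀ {k} d → Dom (d + k) Y → ¬ Dom k Y → ¬ ¬ (∃ λ N → Dom (suc N) Y × ¬ Dom N Y × k ≤ N)
    minDom zero    D nd = ⊥-elim (nd D)
    minDom {k} (suc d) D nd = em-case (λ D′ → minDom d D′ nd) (λ n → return (d + k , D , n , m≤n+m k d))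

    dominated : ¬ ¬ Dom (domBound ℓ c a) Y
    dominated nd = Dom-all λ D → minDom (length allV) (Dom-≤ (m≤m+n _ _) D) nd
        λ { (N , (Z , lZ , Z⊆ , dZ) , nN , K≤N) →
          let e = suc a * ℓ
              -- One more than the size allowed for `E`, so exchanging `S` for `E` saves a vertex
              -- and contradicts minimality.
              m = suc e
              S = take m Z
              D′ = drop m Z
              lS : length S ≤ m
              lS = ≤-trans (≤-reflexive (length-take m Z)) (m⊓n≤m m _)
              star : ∀ E → All Y E → length E ≤ e → ¬ ¬ (∃ λ y → Y y × domBy S y × ¬ domBy E y)
              star E E⊆ lE k = nN (E ++ D′ , lemma N Z E lE lZ (≤-trans (m≤n⊔m (domNeed ℓ c a m m) m) K≤N) ,
                AllP.++⁺ E⊆ (AllP.drop⁺ m Z⊆) ,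
                λ y Yy → case domBy? (E ++ D′) y of λ
                  { (yes p) → p
                  ; (no ¬p) → ⊥-elim (k (y , Yy ,
                      (case AnyP.++⁻ S (subst (λ L → domBy L y) (sym (take++drop≡id m Z)) (dZ y Yy)) of λ
                        { (inj₁ p) → p ; (inj₂ p) → ⊥-elim (¬p (AnyP.++⁺ʳ E p)) }) ,
                      ¬p ∘ AnyP.++⁺ˡ)) })
          in tree S e star a 0 m m S [] (map (λ s → s , []) S) (+-identityʳ a)
               (≤-trans (≤-reflexive (+-identityʳ _)) lS)
               (≤-trans (≤-reflexive (length-map _ S)) lS)
               (AllP.take⁺ m Z⊆) []
               (AllP.map⁺ (All.tabulate λ {s} s∈ → ok (Y⊆X s (All.lookup (AllP.take⁺ m Z⊆) s∈)) (s∈ ∷ []) [] [] [] refl))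
               (λ y Yy dS _ → inits dS)
               (≤-reflexive (+-identityʳ _))
               (nd ∘ Dom-≤ (m≤m⊔n _ _)) }
      where
      lemma : ∀ N Z E → length E ≤ suc a * ℓ → length Z ≤ suc N → suc (suc a * ℓ) ≤ N →
        length (E ++ drop (suc (suc a * ℓ)) Z) ≤ N
      lemma N Z E lE lZ m≤N = begin
        length (E ++ drop (suc e) Z)           ≡⟨ length-++ E ⟩
        length E + length (drop (suc e) Z)     ≡⟨ cong (length E +_) (length-drop (suc e) Z) ⟩
        length E + (length Z ∸ suc e)          ≤⟨ +-mono-≤ lE (∸-monoˡ-≤ (suc e) lZ) ⟩
        e + (N ∸ e)                            ≡⟨ m+[n∸m]≡n (≤-trans (n≤1+n e) m≤N) ⟩
        N ∎
        where
        open ≤-Reasoning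
        e = suc a * ℓ
      inits : ∀ {S y} → domBy S y → y ∈ S ⊎ Any (λ ch → All (_⟶ y) (verts ch)) (map (λ s → s , []) S)
      inits (here (inj₁ e)) = inj₁ (here e)
      inits (here (inj₂ r)) = inj₂ (here (r ∷ []))
      inits (there m)       = Sum.map there there (inits m)

-- Constants of the embedding argument.

setCount : ℕ → ℕ → ℕ
setCount zero    _       = 0
setCount (suc n) zero    = 1
-- One set for the apex, a group for the first smaller copy of `D`, and a group so large that,
-- however it is split in two, one part continues the chain or the other holds the second copy.
setCount (suc n) (suc k) = suc (setCount (suc n) k + (setCount n (suc k) + setCount (suc n) k))

cost : ℕ → ℕ → ℕ
cost zero    _       = 0
cost (suc n) zero    = 1
-- One level pays for the choice inside the first set. After that either the chain continues or two
-- copies are embedded in succession.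
cost (suc n) (suc k) = suc (cost n (suc k) ⊔ (cost (suc n) k + cost (suc n) k))

-- Removing `ℓ` single vertices and `ℓ` sets of clique number at most `lev N ℓ c e` from a set above
-- level `suc e` leaves a set above level `e`. The base level survives `N` binary splittings with
-- `N * c + c` to spare, for the exceptional sets of a generic vertex and for finding a certificate.
lev : ℕ → ℕ → ℕ → ℕ → ℕ
lev N ℓ c zero    = 2 ^ N * (N * c + c)
lev N ℓ c (suc e) = lev N ℓ c e + ℓ * suc (lev N ℓ c e)

-- The size the source of tags needs for `r` more tags in `build`: a tag must avoid the exceptional
-- set of `smallOut`, two of `fewSeeLittle`, and one more for each set already present.
uLev : ℕ → ℕ → ℕ → ℕ → ℕ
uLev N K c zero    = 0
uLev N K c (suc r) = (K * suc (uLev N K c r) + (c + c)) + N * c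

split-length : ∀ {A : Set ℓ₁} p {q} (xs : List A) → length xs ≡ p + q →
  ∃₂ λ ys zs → xs ≡ ys ++ zs × length ys ≡ p × length zs ≡ q
split-length zero    xs       e = [] , xs , refl , refl , e
split-length (suc p) (x ∷ xs) e with split-length p xs (suc-injective e)
... | ys , zs , refl , e₁ , e₂ = x ∷ ys , zs , refl , cong suc e₁ , e₂

-- Exceptional sets of bounded clique number.

module Core (𝕋 : Tourn) where
  open Tourn 𝕋
  open Tour 𝕋
  module Op = Tour (op 𝕋)

  -- Reversing the order together with all arcs preserves the backedges.
  Ω⇒Op : ∀ {k} {Y : V → Set ℓ₁} → Ω k Y → Op.Ω k Y
  Ω⇒Op {k = k} (order L g c) = Op.order (reverse L)
    (λ K s ap → subst (_≤ k) (length-reverse K)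
      (g (reverse K) (subst (reverse K ⊑_) (reverse-involutive L) (Sub.reverse⁺ s)) (AllPairs-reverse ap)))
    λ v y → AnyP.reverse⁺ (c v y)

  -- The interface between the induction and a single step: `cert-free` is the induction hypothesis,
  -- and the prohibitions come from the excluded tournaments.
  record AmbientData : Set₁ where
    field
      X         : V → Set
      Cert      : List V → Set
      ℓ c a b   : ℕ
      cert-len  : ∀ {xs} → Cert xs → length xs ≤ ℓ
      cert-ne   : ∀ {xs} → Cert xs → ∃ (_∈ xs)
      cert-free : ∀ (Y : V → Set) → ¬ (∃ λ xs → Cert xs × All Y xs) → ¬ ¬ Ω c (λ v → X v × Y v)
      noTriangle        : ∀ w {xs ys} → X w → Cert xs → Cert ys → All (w ⟶_) xs → All (_⟶ w) ys → xs ⇒ ys → ⊥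
      noChain        : ∀ ps → All (λ p → X (proj₁ p) × Cert (proj₂ p) × All (proj₁ p ⟶_) (proj₂ p)) ps →
                  AllPairs Full ps → length ps ≡ a → ⊥
      noChainᵒᵖ       : ∀ ps → All (λ p → X (proj₁ p) × Cert (proj₂ p) × All (_⟶ proj₁ p) (proj₂ p)) ps →
                  AllPairs Op.Full ps → length ps ≡ a → ⊥
      noD       : ∀ (f : DV b → V) → (∀ x → X (f x)) → ¬ (∀ x y → D-arc b x y ≡ true → f x ⟶ f y)

  module Ambient (𝔸 : AmbientData) where
    open AmbientData 𝔸

    ω : ℕ → (V → Set ℓ₁) → Set ℓ₁
    ω t Y = Ω t (λ v → X v × Y v)

    ω-mono : ∀ {k} {Y : V → Set ℓ₁} {Z : V → Set ℓ₂} → (∀ v → X v → Z v → Y v) → ω k Y → ω k Z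
    ω-mono i = Ω-mono λ v p → proj₁ p , i v (proj₁ p) (proj₂ p)

    ω-∪ : ∀ {k l} {Y : V → Set ℓ₁} {Z : V → Set ℓ₂} {W : V → Set ℓ₃} →
      (∀ v → X v → W v → ¬ ¬ (Y v ⊎ Z v)) → ω k Y → ω l Z → ω (k + l) W
    ω-∪ i = Ω-∪ λ v p → i v (proj₁ p) (proj₂ p) >>= λ s → return (Sum.map (proj₁ p ,_) (proj₁ p ,_) s)

    ω-one : {Y : V → Set ℓ₁} (x : V) → (∀ v → Y v → v ≡ x) → ω 1 Y
    ω-one x e = Ω-one x λ v p → e v (proj₂ p)

    ω-list : ∀ {A : Set ℓ₁} {t} {P : A → V → Set ℓ₂} (zs : List A) → All (λ z → ω t (P z)) zs →
      ω (length zs * t) (λ v → Any (λ z → P z v) zs)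
    ω-list zs ps = Ω-mono (λ v p → Any.map (proj₁ p ,_) (proj₂ p)) (Ω-list zs ps)

    -- This is how generic vertices are found: a set exceeding the total bound of all exceptional
    -- sets cannot lie inside their union.
    pick : ∀ {k} {U : V → Set ℓ₁} {B : V → Set ℓ₂} → ¬ ω k U → ω k B → ¬ ¬ (∃ λ u → X u × U u × ¬ B u)
    pick n o k = n (ω-mono-¬¬ (λ v x u nb → k (v , x , u , nb)) o)
      where
      ω-mono-¬¬ : ∀ {k} {U : V → Set ℓ₁} {B : V → Set ℓ₂} → (∀ v → X v → U v → ¬ ¬ B v) → ω k B → ω k U
      ω-mono-¬¬ i (order L g c) = order L g λ v p →
        decidable-stable (v ∈? L) (i v (proj₁ p) (proj₂ p) >>= λ b → return (c v (proj₁ p , b)))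

    K : ℕ
    K = domBound ℓ c a

    private
      cert-free-Ω : ∀ (Y : V → Set) → (∀ v → Y v → X v) → ¬ (∃ λ xs → Cert xs × All Y xs) → ¬ ¬ Ω c Y
      cert-free-Ω Y Y⊆X n = cert-free Y n >>= λ o → return (Ω-mono (λ v y → Y⊆X v y , y) o)

      ⇒-flip : ∀ {R : V → V → Set} {xs ys} → All (λ x → All (R x) ys) xs → All (λ y → All (λ x → R x y) xs) ys
      ⇒-flip p = All.tabulate λ y∈ → All.map (λ q → All.lookup q y∈) p

    dataOut : DomData
    dataOut = record
      { X = X ; Cert = Cert ; ℓ = ℓ ; c = c ; a = a ; cert-len = cert-len ; cert-ne = cert-ne
      ; cert-free = λ Y Y⊆X n → cert-free-Ω Y Y⊆X n >>= Ω⇒Dom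
      ; noTriangle = noTriangle ; noChain = noChain }

    dataIn : Op.DomData
    dataIn = record
      { X = X ; Cert = Cert ; ℓ = ℓ ; c = c ; a = a ; cert-len = cert-len ; cert-ne = cert-ne
      ; cert-free = λ Y Y⊆X n → cert-free-Ω Y Y⊆X n >>= λ o → Op.Ω⇒Dom (Ω⇒Op o)
      ; noTriangle = λ w Xw cx cy p q r → noTriangle w Xw cy cx q p (⇒-flip r) ; noChain = noChainᵒᵖ }

    -- At most `K` of these vertices dominate all of them, and each dominator accounts for itself
    -- and for out-neighbours in `U` of clique number at most `t`.
    smallOut : ∀ (U : V → Set) t → ¬ ¬ ω (K * suc t) (λ u → U u × ω t (λ x → U x × u ⟶ x))
    smallOut U t = DomLemma.dominated dataOut (λ u → X u × U u × ω t (λ x → U x × u ⟶ x)) (λ _ → proj₁) >>= λ where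
      (Z , l , a , d) → return (Ω-≤ (*-monoˡ-≤ (suc t) l)
        (Ω-mono (λ v p → Any.map (λ { (inj₁ e) → inj₁ e ; (inj₂ r) → inj₂ (proj₁ p , proj₁ (proj₂ p) , r) }) (d v p))
          (Ω-list Z (All.map (λ {z} q → Ω-∪ {Y = _≡ z} {Z = λ v → X v × U v × z ⟶ v} (λ _ → return)
                                         (Ω-one z (λ _ e → e)) (proj₂ (proj₂ q))) a))))

    smallIn : ∀ (U : V → Set) t → ¬ ¬ ω (K * suc t) (λ u → U u × ω t (λ x → U x × x ⟶ u))
    smallIn U t = Op.DomLemma.dominated dataIn (λ u → X u × U u × ω t (λ x → U x × x ⟶ u)) (λ _ → proj₁) >>= λ where
      (Z , l , a , d) → return (Ω-≤ (*-monoˡ-≤ (suc t) l)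
        (Ω-mono (λ v p → Any.map (λ { (inj₁ e) → inj₁ e ; (inj₂ r) → inj₂ (proj₁ p , proj₁ (proj₂ p) , r) }) (d v p))
          (Ω-list Z (All.map (λ {z} q → Ω-∪ {Y = _≡ z} {Z = λ v → X v × U v × v ⟶ z} (λ _ → return)
                                         (Ω-one z (λ _ e → e)) (proj₂ (proj₂ q))) a))))

    -- If many u see only a small part of W along R, a certificate made of such u
    -- leaves a large part of W on its other side.
    fewSeeLittle : (R : V → V → Set) → (∀ u v → u ≡ v ⊎ R u v ⊎ R v u) → ∀ {U W : V → Set} t →
      (∀ {ys zs} → Cert ys → Cert zs → All U ys → All W zs → All (λ z → All (R z) ys) zs → ⊥) →
      ¬ ω (c + ℓ * suc t) W → ¬ ¬ ω c (λ u → U u × ω t (λ x → W x × R u x))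
    fewSeeLittle R triR {U} {W} t np nW = cert-free _ λ { (ys , cy , q) →
      cert-free (λ x → W x × All (R x) ys)
        (λ { (zs , cz , r) → np cy cz (All.map proj₁ q) (All.map proj₁ r) (All.map proj₂ r) })
        λ o → nW (Ω-≤ (+-monoʳ-≤ c (*-monoˡ-≤ (suc t) (cert-len cy)))
          (ω-∪ {Z = λ v → Any (λ y → v ≡ y ⊎ (W v × R y v)) ys}
            (λ v _ w → return (Sum.map (w ,_) (Any.map (Sum.map₂ (w ,_))) (side v ys))) o
            (ω-list ys (All.map (λ {y} p → ω-∪ (λ _ _ → return) (ω-one y λ _ e → e) (proj₂ p)) q)))) }
      where
      side : ∀ v ys → All (R v) ys ⊎ Any (λ y → v ≡ y ⊎ R y v) ys
      side v [] = inj₁ []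
      side v (y ∷ ys) with triR v y
      ... | inj₁ e        = inj₂ (here (inj₁ e))
      ... | inj₂ (inj₂ r) = inj₂ (here (inj₂ r))
      ... | inj₂ (inj₁ r) = Sum.map (r ∷_) there (side v ys)

    NoPure : (V → Set) → (V → Set) → Set
    NoPure U W = ∀ {xs ys} → Cert xs → Cert ys → All U xs → All W ys → xs ⇒ ys → ⊥

    fewSeeLittleOut : ∀ {U W} t → NoPure W U → ¬ ω (c + ℓ * suc t) W →
      ¬ ¬ ω c (λ u → U u × ω t (λ x → W x × u ⟶ x))
    fewSeeLittleOut t np = fewSeeLittle _⟶_ tri t λ cy cz p q r → np cz cy q p r

    fewSeeLittleIn : ∀ {U W} t → NoPure U W → ¬ ω (c + ℓ * suc t) W →
      ¬ ¬ ω c (λ u → U u × ω t (λ x → W x × x ⟶ u))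
    fewSeeLittleIn t np = fewSeeLittle (flip _⟶_) (λ u v → Sum.map₂ Sum.swap (tri u v)) t λ cy cz p q r → np cy cz p q (⇒-flip r)

    ω-≤ : ∀ {k l} {Y : V → Set ℓ₁} → k ≤ l → ω k Y → ω l Y
    ω-≤ = Ω-≤

    -- Tagged sets between the vertices of a back-clique.

    module Tagged (N : ℕ) where

      TS : Set₁
      TS = V × (V → Set)

      lv : ℕ → ℕ
      lv = lev N ℓ c

      lv-mono : ∀ {e e′} → e ≤ e′ → lv e ≤ lv e′
      lv-mono {zero} {zero} _ = ≤-refl
      lv-mono {e} {suc e′} le with m≤n⇒m<n∨m≡n le
      ... | inj₁ lt   = ≤-trans (lv-mono (s≤s⁻¹ lt)) (m≤m+n _ _)
      ... | inj₂ refl = ≤-refl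

      base≤lv : ∀ e → 2 ^ N * (N * c + c) ≤ lv e
      base≤lv e = lv-mono {e′ = e} z≤n

      Nc+c≤lv : ∀ e → N * c + c ≤ lv e
      Nc+c≤lv e = ≤-trans (m≤n*m (N * c + c) (2 ^ N) ⦃ m^n≢0 2 N ⦄) (base≤lv e)

      badLv : ∀ e → c + ℓ * suc (lv e) ≤ lv (suc e)
      badLv e = +-monoˡ-≤ _ (≤-trans (m≤n+m c (N * c)) (Nc+c≤lv e))

      record Rich (e : ℕ) (p : TS) : Set where
        constructor rich
        field large : ¬ ω (lv e) (proj₂ p)
      open Rich

      rich-≤ : ∀ {e e′} {p : TS} → e ≤ e′ → Rich e′ p → Rich e p
      rich-≤ le (rich n) = rich λ o → n (ω-≤ (lv-mono le) o)

      record OwnT (p : TS) : Set where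
        constructor ownT
        field
          tagX : X (proj₁ p)
          tag⟶ : ∀ x → proj₂ p x → proj₁ p ⟶ x
      open OwnT

      -- `Full` with certificates loosened to sets and the arcs between the two sets left open.
      record RelT (p q : TS) : Set where
        constructor relT
        field
          tags : proj₁ q ⟶ proj₁ p
          out  : ∀ x → proj₂ q x → proj₁ p ⟶ x
          in′  : ∀ x → proj₂ p x → x ⟶ proj₁ q
      open RelT

      -- A certificate of the later set beating one of the earlier set would form a triangle with
      -- the later tag.
      noPureT : ∀ {p q} → RelT p q → OwnT q → NoPure (proj₂ q) (proj₂ p)
      noPureT (relT _ _ r) (ownT Xv o) cx cy p q s = noTriangle _ Xv cx cy (All.map (o _) p) (All.map (r _) q) s

      record _≼_ (p q : TS) : Set where
        constructor sub
        field
          tag≡ : proj₁ p ≡ proj₁ q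
          set⊆ : ∀ x → proj₂ p x → proj₂ q x

      ≼-refl : ∀ {p} → p ≼ p
      ≼-refl = sub refl λ _ → id

      _⊴_ : List TS → List TS → Set₁
      _⊴_ = HS.Sublist _≼_

      ⊴-trans : ∀ {ps qs rs} → ps ⊴ qs → qs ⊴ rs → ps ⊴ rs
      ⊴-trans = HSP.trans λ { (sub refl f) (sub refl g) → sub refl λ x → g x ∘ f x }

      ⊴-refl : ∀ {ps} → ps ⊴ ps
      ⊴-refl = HSP.refl ≼-refl

      ⊑⇒⊴ : ∀ {ps qs} → ps ⊑ qs → ps ⊴ qs
      ⊑⇒⊴ []         = HS.[]
      ⊑⇒⊴ (y ∷ʳ s)   = y HS.∷ʳ ⊑⇒⊴ s
      ⊑⇒⊴ (refl ∷ s) = ≼-refl HS.∷ ⊑⇒⊴ s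

      restrict : (V → Set) → TS → TS
      restrict φ (v , W) = v , λ x → W x × φ x

      restrict-⊴ : ∀ φ ps → map (restrict φ) ps ⊴ ps
      restrict-⊴ φ []       = HS.[]
      restrict-⊴ φ (p ∷ ps) = sub refl (λ _ → proj₁) HS.∷ restrict-⊴ φ ps

      ⊴-All : {P : TS → Set} → (∀ {p q} → p ≼ q → P q → P p) → ∀ {ps qs} → ps ⊴ qs → All P qs → All P ps
      ⊴-All f HS.[]        []       = []
      ⊴-All f (y HS.∷ʳ s)  (p ∷ ps) = ⊴-All f s ps
      ⊴-All f (r HS.∷ s)   (p ∷ ps) = f r p ∷ ⊴-All f s ps

      ⊴-Any : {P : TS → Set} → (∀ {p q} → p ≼ q → P p → P q) → ∀ {ps qs} → ps ⊴ qs → Any P ps → Any P qs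
      ⊴-Any f (y HS.∷ʳ s) m         = there (⊴-Any f s m)
      ⊴-Any f (r HS.∷ s)  (here p)  = here (f r p)
      ⊴-Any f (r HS.∷ s)  (there m) = there (⊴-Any f s m)

      ⊴-own : ∀ {ps qs} → ps ⊴ qs → All OwnT qs → All OwnT ps
      ⊴-own = ⊴-All λ { (sub refl i) (ownT x o) → ownT x λ y w → o y (i y w) }

      ⊴-rel : ∀ {ps qs} → ps ⊴ qs → AllPairs RelT qs → AllPairs RelT ps
      ⊴-rel HS.[]       []       = []
      ⊴-rel (y HS.∷ʳ s) (p ∷ ps) = ⊴-rel s ps
      ⊴-rel (sub refl i HS.∷ s) (p ∷ ps) =
        ⊴-All (λ { (sub refl j) (relT u v w) → relT u (λ x m → v x (j x m)) w }) s
          (All.map (λ { (relT u v w) → relT u v λ x m → w x (i x m) }) p) ∷ ⊴-rel s ps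

      -- `Full` again, between a finished pair and a set whose certificate is not chosen yet.
      record Before (p : Pair) (q : TS) : Set where
        constructor prefix
        field
          ptags : proj₁ q ⟶ proj₁ p
          pout  : ∀ x → proj₂ q x → proj₁ p ⟶ x
          pin   : All (_⟶ proj₁ q) (proj₂ p)
          pcert : ∀ x → proj₂ q x → All (_⟶ x) (proj₂ p)

      Before-≼ : ∀ {p q q′} → q ≼ q′ → Before p q′ → Before p q
      Before-≼ (sub refl i) (prefix r s t u) = prefix r (λ x m → s x (i x m)) t λ x m → u x (i x m)

      OwnP : Pair → Set
      OwnP p = X (proj₁ p) × Cert (proj₂ p) × All (proj₁ p ⟶_) (proj₂ p)

      -- A generic vertex has large out-neighbourhoods in later sets, but its in-neighbourhoods
      -- there may be small. All of `W′` agrees on the sets where they are small, `Fs`, and where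
      -- they are large, `Ss`.
      record Classified (t s : ℕ) (gs : List TS) (W : V → Set) : Set₁ where
        constructor classified
        field
          W′    : V → Set
          W′⊆   : ∀ x → W′ x → W x
          nW′   : ¬ ω s W′
          Fs Ss : List TS
          sF    : Fs ⊑ gs
          sS    : Ss ⊑ gs
          lens  : length gs ≡ length Fs + length Ss
          pF    : ∀ x → W′ x → All (λ g → ω t (λ y → proj₂ g y × y ⟶ x)) Fs
          pS    : ∀ x → W′ x → All (λ g → ¬ ω t (λ y → proj₂ g y × y ⟶ x)) Ss

      -- Each `g` splits `W` in two, and one part stays above half of the threshold; hence the power
      -- of two.
      classify : ∀ t s (gs : List TS) (W : V → Set) → ¬ ω (2 ^ length gs * s) W →
        ¬ ¬ Classified t s gs W
      classify t s [] W n = return (classified W (λ _ → id) (λ o → n (ω-≤ (≤-reflexive (sym (+-identityʳ s))) o))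
        [] [] [] [] refl (λ _ _ → []) λ _ _ → [])
      classify t s (g ∷ gs) W n = em-case
        (λ o → classify t s gs (λ x → W x × ¬ ω t (λ y → proj₂ g y × y ⟶ x))
            (λ o′ → n (ω-≤ (≤-reflexive (trans (cong (m * s +_) (sym (+-identityʳ (m * s))))
                                                (sym (*-assoc 2 m s))))
              (ω-∪ (λ v _ w → em-case (λ p → return (inj₁ (w , p))) (λ p → return (inj₂ (w , p)))) o o′)))
          >>= λ { (classified W′ i nW Fs Ss sF sS e pF pS) → return
            (classified W′ (λ x → proj₁ ∘ i x) nW Fs (g ∷ Ss) (g ∷ʳ sF) (refl ∷ sS)
             (trans (cong suc e) (sym (+-suc (length Fs) (length Ss)))) pF λ x w → proj₂ (i x w) ∷ pS x w) })
        (λ no → classify t s gs (λ x → W x × ω t (λ y → proj₂ g y × y ⟶ x)) no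
          >>= λ { (classified W′ i nW Fs Ss sF sS e pF pS) → return
            (classified W′ (λ x → proj₁ ∘ i x) nW (g ∷ Fs) Ss (refl ∷ sF) (g ∷ʳ sS) (cong suc e)
             (λ x w → proj₂ (i x w) ∷ pF x w) pS) })
        where m = 2 ^ length gs

      -- Completing a chain or embedding `D` greedily.

      module Embed (base : List TS) (baseN : length base ≤ N)
                   (baseOwn : All OwnT base) (baseRel : AllPairs RelT base) where

        -- The sets in `rs` keep a rich common out-neighbourhood, so that another copy can be placed
        -- there afterwards.
        record DEmb (k e : ℕ) (ws rs : List TS) : Set₁ where
          constructor demb
          field
            f    : DV k → V
            arcs : ∀ x y → D-arc k x y ≡ true → f x ⟶ f y
            mem  : ∀ x → X (f x) × Any (λ w → proj₂ w (f x)) ws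
            rest : All (λ r → Rich e (restrict (λ y → ∀ x → f x ⟶ y) r)) rs

        -- The induction statement: with `n` pairs missing from the chain `pre`, either the chain
        -- gets completed, which is absurd, or `DV k` finds room in `ws` while `rs` stays rich.
        Emb : ℕ → ℕ → Set₁
        Emb n k = ∀ e pre ws rs → length pre + n ≡ a → All OwnP pre → AllPairs (flip Full) pre →
          All (λ p → All (Before p) ws) pre → length ws ≡ setCount n k → (ws ++ rs) ⊴ base →
          All (Rich (cost n k + e)) (ws ++ rs) → ¬ ¬ DEmb k e ws rs

        -- By `noPureT`, each later set is unsuitable only for vertices of total clique number at
        -- most `c`, and there are fewer than `N` later sets.
        generic : ∀ e {w₀ rs} {W : V → Set} → (∀ x → W x → proj₂ w₀ x) → (w₀ ∷ rs) ⊴ base → All (Rich (suc e)) rs →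
          ¬ ω (N * c) W → ¬ ¬ (∃ λ u → X u × W u × All (λ r → Rich e (restrict (u ⟶_) r)) rs)
        generic e {w₀} {rs} {W} i s rch nW =
          ¬¬-All (All.zipWith (λ { ((rel , own) , r) → fewSeeLittleOut {U = W} (lv e)
                    (λ cx cy p q → noPureT rel own cx cy p (All.map (i _) q)) (large r ∘ ω-≤ (badLv e)) })
                  (All.zip (AllPairs.head (⊴-rel s baseRel) , All.tail (⊴-own s baseOwn)) , rch)) >>= λ bads →
          pick nW (ω-≤ (*-monoˡ-≤ c (≤-trans (n≤1+n _) (≤-trans (HSP.length-mono-≤ s) baseN))) (ω-list rs bads)) >>= λ where
            (u , Xu , Wu , nb) → return (u , Xu , Wu , All.map (λ n → rich λ o → n (Wu , o)) (AllP.¬Any⇒All¬ rs nb))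

        emb-zero : ∀ k → Emb zero k
        emb-zero k e pre ws rs l own full _ _ _ _ = λ _ →
          noChain (reverse pre) (All-reverse own) (AllPairs-reverse full)
             (trans (length-reverse pre) (trans (sym (+-identityʳ _)) l))

        emb-one : ∀ n → Emb (suc n) zero
        emb-one n e pre (w₀ ∷ []) rs l own full pr _ s (r₀ ∷ rch) =
          generic e (λ _ → id) s rch (large r₀ ∘ ω-≤ (≤-trans (m≤m+n _ _) (Nc+c≤lv (suc e)))) >>= λ where
            (u , Xu , Wu , g) → return (demb (λ _ → u) (λ _ _ ()) (λ _ → Xu , here Wu)
              (All.map (λ {r} (rich n) → rich λ o → n (ω-mono (λ v _ p → proj₁ p , λ _ → proj₂ p) o)) g))

        module StepE (n k : ℕ) (IHn : Emb n (suc k)) (IHk : Emb (suc n) k) (e : ℕ) (pre : List Pair)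
          (w₀ : TS) (G₁ Gc rs : List TS) (l : length pre + suc n ≡ a) (own : All OwnP pre)
          (full : AllPairs (flip Full) pre) (pr : All (λ p → All (Before p) (w₀ ∷ G₁ ++ Gc)) pre)
          (lG₁ : length G₁ ≡ setCount (suc n) k) (lGc : length Gc ≡ setCount n (suc k) + setCount (suc n) k)
          (s : (w₀ ∷ (G₁ ++ Gc) ++ rs) ⊴ base)
          (r₀ : Rich (cost (suc n) (suc k) + e) w₀)
          (rG₁ : All (Rich (cost (suc n) (suc k) + e)) G₁)
          (rGc : All (Rich (cost (suc n) (suc k) + e)) Gc)
          (rrs : All (Rich (cost (suc n) (suc k) + e)) rs)
          where

          e₁ : ℕ
          e₁ = (cost n (suc k) ⊔ (cost (suc n) k + cost (suc n) k)) + e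

          t : ℕ
          t = lv e₁

          rels : All (RelT w₀) (G₁ ++ Gc)
          rels = AllP.++⁻ˡ (G₁ ++ Gc) (AllPairs.head (⊴-rel s baseRel))

          v₀ : V
          v₀ = proj₁ w₀

          ownW : OwnT w₀
          ownW = All.head (⊴-own s baseOwn)

          sTail : ((G₁ ++ Gc) ++ rs) ⊴ base
          sTail = ⊴-trans (w₀ HS.∷ʳ ⊴-refl) s

          module _ (W′ : V → Set) (W′⊆ : ∀ x → W′ x → proj₂ w₀ x) (nW′ : ¬ ω (N * c + c) W′) where

            -- Every vertex of `W′` beats most of each set in `Fs`. A certificate in `W′` therefore
            -- has rich common out-neighbourhoods there, and paired with `v₀` it lengthens the
            -- chain.
            caseF : ∀ Fs → Fs ⊑ Gc → length Fs ≡ setCount n (suc k) →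
              (∀ x → W′ x → All (λ g → ω t (λ y → proj₂ g y × y ⟶ x)) Fs) → ¬ ¬ DEmb (suc k) e (w₀ ∷ G₁ ++ Gc) rs
            caseF Fs sF lF pF q = cert-free W′ (λ { (xs , cx , x⊆) → go xs cx x⊆ q })
              (λ o → nW′ (ω-≤ (m≤n+m c (N * c)) o))
              where
              go : ∀ xs → Cert xs → All W′ xs → ¬ ¬ DEmb (suc k) e (w₀ ∷ G₁ ++ Gc) rs
              go xs cx x⊆ = IHn e ((v₀ , xs) ∷ pre) Fs′ rs (trans (sym (+-suc _ n)) l)
                  ((tagX ownW , cx , All.map (λ w → tag⟶ ownW _ (W′⊆ _ w)) x⊆) ∷ own)
                  (All.map (λ { (prefix p₁ p₂ p₃ p₄) →
                       p₁ , All.map (λ w → p₂ _ (W′⊆ _ w)) x⊆ , p₃ ,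
                       All.tabulate (λ z∈ → All.map (λ w → All.lookup (p₄ _ (W′⊆ _ w)) z∈) x⊆) })
                     (All.map All.head pr) ∷ full)
                  (AllP.map⁺ (All.map (λ { (relT r₁ r₂ r₃) →
                       prefix r₁ (λ x w → r₂ x (proj₁ w)) (All.map (λ w → r₃ _ (W′⊆ _ w)) x⊆) λ x w → proj₂ w }) relF) ∷
                   All.map (λ p → ⊴-All Before-≼ F′⊴ (AllP.++⁻ʳ G₁ (All.tail p))) pr)
                  (trans (length-map _ Fs) lF)
                  (⊴-trans (HSP.++⁺ F′⊴ (⊴-refl))
                     (⊴-trans (subst ((Gc ++ rs) ⊴_) (sym (++-assoc G₁ Gc rs)) (HSP.++ˡ G₁ (⊴-refl))) sTail))
                  (AllP.++⁺ (AllP.map⁺ (All.tabulate λ f∈ → rich-≤ leF (richF f∈)))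
                            (All.map (rich-≤ (≤-trans leF (n≤1+n _))) rrs))
                >>= λ { (demb f arcs mem rr) → return (demb f arcs
                      (λ x → proj₁ (mem x) , there (AnyP.++⁺ʳ G₁ (⊴-Any (λ p → _≼_.set⊆ p _) F′⊴ (proj₂ (mem x))))) rr) }
                where
                leF : cost n (suc k) + e ≤ e₁
                leF = +-monoˡ-≤ e (m≤m⊔n (cost n (suc k)) _)
                Fs′ = map (restrict (λ y → All (_⟶ y) xs)) Fs
                F′⊴ : Fs′ ⊴ Gc
                F′⊴ = ⊴-trans (restrict-⊴ _ Fs) (⊑⇒⊴ sF)
                relF : All (RelT w₀) Fs
                relF = All-resp-⊑ sF (AllP.++⁻ʳ G₁ rels)
                -- Each of the at most `ℓ` vertices of `xs` costs itself and a part of clique number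
                -- at most `t`, which is exactly one level of `lev`.
                richF : ∀ {f} → f ∈ Fs → Rich e₁ (restrict (λ y → All (_⟶ y) xs) f)
                richF {f} f∈ = rich λ o → large (All.lookup (All-resp-⊑ sF rGc) f∈)
                  (ω-≤ (+-monoʳ-≤ t (*-monoˡ-≤ (suc t) (cert-len cx)))
                    (ω-∪ {Z = λ v → Any (λ y → v ≡ y ⊎ (proj₂ f v × v ⟶ y)) xs}
                      (λ v _ w → return (Sum.map (w ,_) (Any.map (Sum.map₂ (w ,_))) (side v xs))) o
                      (ω-list xs (All.map (λ {y} p → ω-∪ (λ _ _ → return) (ω-one y λ _ e → e) (All.lookup (pF y p) f∈)) x⊆))))
                  where
                  side : ∀ v ys → All (_⟶ v) ys ⊎ Any (λ y → v ≡ y ⊎ v ⟶ y) ys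
                  side v [] = inj₁ []
                  side v (y ∷ ys) with tri v y
                  ... | inj₁ e        = inj₂ (here (inj₁ e))
                  ... | inj₂ (inj₁ r) = inj₂ (here (inj₂ r))
                  ... | inj₂ (inj₂ r) = Sum.map (r ∷_) there (side v ys)

            -- A generic `w` in `W′` becomes the apex. The first copy goes to its out-neighbours in
            -- `G₁`, the second to those in-neighbours in `Ss` that the first copy beats.
            caseS : ∀ Ss → Ss ⊑ Gc → length Ss ≡ setCount (suc n) k →
              (∀ x → W′ x → All (λ g → ¬ ω t (λ y → proj₂ g y × y ⟶ x)) Ss) → ¬ ¬ DEmb (suc k) e (w₀ ∷ G₁ ++ Gc) rs
            caseS Ss sS lS pS =
              generic e₁ W′⊆ sGen (AllP.++⁺ rG₁ rrs) (λ o → nW′ (ω-≤ (m≤m+n _ _) o)) >>= λ where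
                (w , Xw , Ww , g) → go w Xw Ww (AllP.++⁻ˡ G₁ g) (AllP.++⁻ʳ G₁ g)
              where
              sGen : (w₀ ∷ G₁ ++ rs) ⊴ base
              sGen = ⊴-trans (≼-refl HS.∷
                HSP.++⁺ (subst (_⊴ (G₁ ++ Gc)) (++-identityʳ G₁) (HSP.++⁺ (⊴-refl) (HS.minimum Gc)))
                        (⊴-refl)) s
              go : ∀ w → X w → W′ w → All (λ r → Rich e₁ (restrict (w ⟶_) r)) G₁ →
                   All (λ r → Rich e₁ (restrict (w ⟶_) r)) rs → ¬ ¬ DEmb (suc k) e (w₀ ∷ G₁ ++ Gc) rs
              go w Xw Ww gG gr =
                -- The first copy must leave `ck + e` levels, because the second copy costs `ck`
                -- more.
                IHk (ck + e) pre G₁′ (G₂′ ++ rs′) l own full (All.map (λ p → ⊴-All Before-≼ G₁′⊴ (AllP.++⁻ˡ G₁ (All.tail p))) pr)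
                    (trans (length-map _ G₁) lG₁)
                    (⊴-trans (subst (_⊴ ((G₁ ++ Gc) ++ rs)) (++-assoc G₁′ G₂′ rs′)
                               (HSP.++⁺ (HSP.++⁺ G₁′⊴ G₂′⊴) (restrict-⊴ _ rs))) sTail)
                    (AllP.++⁺ (AllP.map⁺ (All.map (rich-≤ le₁) gG))
                       (AllP.++⁺ (AllP.map⁺ (All.map (λ r → rich-≤ le₁ (rich r)) (pS w Ww)))
                                 (AllP.map⁺ (All.map (rich-≤ le₁) gr)))) >>= λ where
                  (demb f₁ arcs₁ mem₁ rr₁) → second f₁ arcs₁ mem₁ (AllP.++⁻ˡ G₂′ rr₁) (AllP.++⁻ʳ G₂′ rr₁)
                where
                ck = cost (suc n) k
                G₁′ = map (restrict (w ⟶_)) G₁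
                G₂′ = map (restrict (_⟶ w)) Ss
                rs′ = map (restrict (w ⟶_)) rs
                G₁′⊴ : G₁′ ⊴ G₁
                G₁′⊴ = restrict-⊴ _ G₁
                G₂′⊴ : G₂′ ⊴ Gc
                G₂′⊴ = ⊴-trans (restrict-⊴ _ Ss) (⊑⇒⊴ sS)
                le₁ : ck + (ck + e) ≤ e₁
                le₁ = ≤-trans (≤-reflexive (sym (+-assoc ck ck e))) (+-monoˡ-≤ e (m≤n⊔m (cost n (suc k)) _))
                second : ∀ f₁ → (∀ x y → D-arc k x y ≡ true → f₁ x ⟶ f₁ y) →
                  (∀ x → X (f₁ x) × Any (λ p → proj₂ p (f₁ x)) G₁′) →
                  All (λ r → Rich (ck + e) (restrict (λ y → ∀ x → f₁ x ⟶ y) r)) G₂′ →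
                  All (λ r → Rich (ck + e) (restrict (λ y → ∀ x → f₁ x ⟶ y) r)) rs′ →
                  ¬ ¬ DEmb (suc k) e (w₀ ∷ G₁ ++ Gc) rs
                second f₁ arcs₁ mem₁ rG rR =
                  IHk e pre G₂″ rs″ l own full
                      (All.map (λ p → ⊴-All Before-≼ G₂″⊴ (AllP.++⁻ʳ G₁ (All.tail p))) pr)
                      (trans (length-map _ G₂′) (trans (length-map _ Ss) lS))
                      (⊴-trans (HSP.++⁺ G₂″⊴ (⊴-trans (restrict-⊴ _ rs′) (restrict-⊴ _ rs)))
                        (⊴-trans (subst ((Gc ++ rs) ⊴_) (sym (++-assoc G₁ Gc rs)) (HSP.++ˡ G₁ (⊴-refl))) sTail))
                      (AllP.++⁺ (AllP.map⁺ rG) (AllP.map⁺ rR)) >>= λ where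
                    (demb f₂ arcs₂ mem₂ rr₂) → return (finish f₂ arcs₂ mem₂ rr₂)
                  where
                  G₂″ = map (restrict (λ y → ∀ x → f₁ x ⟶ y)) G₂′
                  rs″ = map (restrict (λ y → ∀ x → f₁ x ⟶ y)) rs′
                  G₂″⊴ : G₂″ ⊴ Gc
                  G₂″⊴ = ⊴-trans (restrict-⊴ _ G₂′) G₂′⊴
                  finish : ∀ f₂ → (∀ x y → D-arc k x y ≡ true → f₂ x ⟶ f₂ y) →
                    (∀ x → X (f₂ x) × Any (λ p → proj₂ p (f₂ x)) G₂″) →
                    All (λ r → Rich e (restrict (λ y → ∀ x → f₂ x ⟶ y) r)) rs″ →
                    DEmb (suc k) e (w₀ ∷ G₁ ++ Gc) rs
                  finish f₂ arcs₂ mem₂ rr₂ = demb f arcs mem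
                    (All.map (λ {r} (rich n) → rich λ o → n (ω-mono (λ { v _ (((p , q) , q₁) , q₂) →
                        p , λ { (inj₁ (false , x)) → q₁ x ; (inj₁ (true , x)) → q₂ x ; (inj₂ tt) → q } }) o))
                      (AllP.map⁻ (AllP.map⁻ rr₂)))
                    where
                    f : DV (suc k) → V
                    f (inj₁ (false , x)) = f₁ x
                    f (inj₁ (true  , x)) = f₂ x
                    f (inj₂ tt)          = w
                    w⟶f₁ : ∀ x → w ⟶ f₁ x
                    w⟶f₁ x = proj₂ (proj₂ (proj₂ (find (AnyP.map⁻ (proj₂ (mem₁ x))))))
                    inG₂ : ∀ x → ∃ λ g → g ∈ Ss × (proj₂ g (f₂ x) × f₂ x ⟶ w) × (∀ y → f₁ y ⟶ f₂ x)
                    inG₂ x = find (AnyP.map⁻ (AnyP.map⁻ (proj₂ (mem₂ x))))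
                    arcs : ∀ x y → D-arc (suc k) x y ≡ true → f x ⟶ f y
                    arcs (inj₁ (false , x)) (inj₁ (false , y)) p = arcs₁ x y p
                    arcs (inj₁ (true  , x)) (inj₁ (true  , y)) p = arcs₂ x y p
                    arcs (inj₁ (false , x)) (inj₁ (true  , y)) _ = proj₂ (proj₂ (proj₂ (inG₂ y))) x
                    arcs (inj₁ (true  , x)) (inj₂ tt)          _ = proj₂ (proj₁ (proj₂ (proj₂ (inG₂ x))))
                    arcs (inj₂ tt)          (inj₁ (false , y)) _ = w⟶f₁ y
                    mem : ∀ x → X (f x) × Any (λ p → proj₂ p (f x)) (w₀ ∷ G₁ ++ Gc)
                    mem (inj₁ (false , x)) = proj₁ (mem₁ x) , there (AnyP.++⁺ˡ (⊴-Any (λ p → _≼_.set⊆ p _) G₁′⊴ (proj₂ (mem₁ x))))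
                    mem (inj₁ (true  , x)) = proj₁ (mem₂ x) , there (AnyP.++⁺ʳ G₁ (⊴-Any (λ p → _≼_.set⊆ p _) G₂″⊴ (proj₂ (mem₂ x))))
                    mem (inj₂ tt)          = Xw , here (W′⊆ w Ww)

          result : ¬ ¬ DEmb (suc k) e (w₀ ∷ G₁ ++ Gc) rs
          result = classify t (N * c + c) Gc (proj₂ w₀)
              (λ o → large r₀ (ω-≤ (≤-trans (*-monoˡ-≤ (N * c + c) (^-monoʳ-≤ 2 lenGc)) (base≤lv (cost (suc n) (suc k) + e))) o)) >>= λ where
                (classified W′ i nW Fs Ss sF sS le pF pS) → choose W′ i nW Fs Ss sF sS (trans (sym le) lGc) pF pS
            where
            lenGc : length Gc ≤ N
            lenGc = ≤-trans (HSP.length-mono-≤ (⊴-trans (HSP.++ˡ G₁ (⊴-refl))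
                      (⊴-trans (subst (_⊴ ((G₁ ++ Gc) ++ rs)) (++-identityʳ (G₁ ++ Gc))
                         (HSP.++⁺ (⊴-refl) (HS.minimum rs))) sTail))) baseN
            choose : ∀ W′ → (∀ x → W′ x → proj₂ w₀ x) → ¬ ω (N * c + c) W′ → ∀ Fs Ss → Fs ⊑ Gc → Ss ⊑ Gc →
              length Fs + length Ss ≡ setCount n (suc k) + setCount (suc n) k →
              (∀ x → W′ x → All (λ g → ω t (λ y → proj₂ g y × y ⟶ x)) Fs) →
              (∀ x → W′ x → All (λ g → ¬ ω t (λ y → proj₂ g y × y ⟶ x)) Ss) →
              ¬ ¬ DEmb (suc k) e (w₀ ∷ G₁ ++ Gc) rs
            -- Pigeonhole: the length of `Gc` is the sum of the two group sizes wanted.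
            choose W′ i nW Fs Ss sF sS le pF pS with ≤-total (setCount n (suc k)) (length Fs)
            ... | inj₁ p = caseF W′ i nW (take p′ Fs) (⊆-trans (Sub.take-⊆ p′ Fs) sF)
                             (trans (length-take p′ Fs) (m≤n⇒m⊓n≡m p)) (λ x w → AllP.take⁺ p′ (pF x w))
              where p′ = setCount n (suc k)
            ... | inj₂ p = caseS W′ i nW (take p′ Ss) (⊆-trans (Sub.take-⊆ p′ Ss) sS)
                             (trans (length-take p′ Ss) (m≤n⇒m⊓n≡m le′)) (λ x w → AllP.take⁺ p′ (pS x w))
              where
              p′ = setCount (suc n) k
              le′ : p′ ≤ length Ss
              le′ = +-cancelˡ-≤ (length Fs) _ _ (≤-trans (+-monoˡ-≤ p′ p) (≤-reflexive (sym le)))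

        embed : ∀ n k → Emb n k
        embed zero    k       = emb-zero k
        embed (suc n) zero    = emb-one n
        embed (suc n) (suc k) e pre (w₀ ∷ ws) rs l own full pr lw s (r₀ ∷ rch)
          with split-length (setCount (suc n) k) ws (suc-injective lw)
        ... | G₁ , Gc , refl , lG₁ , lGc =
          StepE.result n k (embed n (suc k)) (embed (suc n) k) e pre w₀ G₁ Gc rs l own full pr lG₁ lGc s r₀
            (AllP.++⁻ˡ G₁ (AllP.++⁻ˡ (G₁ ++ Gc) rch)) (AllP.++⁻ʳ G₁ (AllP.++⁻ˡ (G₁ ++ Gc) rch))
            (AllP.++⁻ʳ (G₁ ++ Gc) rch)

      noTagged : N ≡ setCount a b → ∀ base → length base ≡ N → All OwnT base → AllPairs RelT base →
        All (Rich (cost a b)) base → ⊥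
      noTagged eq base l own rel rch =
        Embed.embed base (≤-reflexive l) own rel a b 0 [] base [] refl [] [] [] (trans l eq)
          (subst (_⊴ base) (sym (++-identityʳ base)) (⊴-refl))
          (subst₂ (λ e L → All (Rich e) L) (sym (+-identityʳ (cost a b))) (sym (++-identityʳ base)) rch)
          λ { (Embed.demb f arcs mem _) → noD f (proj₁ ∘ mem) arcs }

    -- Out-neighbourhoods are nearly nested.

    N : ℕ
    N = setCount a b

    open Tagged N
    open Rich
    open OwnT
    open RelT

    E : ℕ
    E = cost a b

    Df : V → V → V → Set
    Df y y′ x = y ⟶ x × x ⟶ y′

    -- A directed triangle inequality: a vertex other than `v` either beats `v` or is beaten by it.
    Df-triangle : ∀ {k l} {u v w} → X v → ω k (Df u v) → ω l (Df v w) → ω (1 + (k + l)) (Df u w)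
    Df-triangle {v = v} Xv o o′ = ω-∪ (λ x _ p → return (split x p)) (ω-one v λ _ e → e) (ω-∪ {Y = Df _ v} {Z = Df v _} (λ _ _ → return) o o′)
      where
      split : ∀ x → Df _ _ x → x ≡ v ⊎ (Df _ v x ⊎ Df v _ x)
      split x (p , q) with tri x v
      ... | inj₁ e        = inj₁ e
      ... | inj₂ (inj₁ r) = inj₂ (inj₁ (p , r))
      ... | inj₂ (inj₂ r) = inj₂ (inj₂ (r , q))

    module Alternating (U₀ W₀ : V → Set) (npUW : NoPure U₀ W₀) (npWU : NoPure W₀ U₀) where

      -- Tags come from `U`, which all present tags beat; sets come from `P`, which beats all
      -- present tags. A new tag `v` goes to the front and cuts `P` in two: its out-neighbours
      -- become the set of `v`, its in-neighbours the new `P`.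
      build : ∀ r (ps : List TS) (P U : V → Set) → length ps + r ≡ N →
        All OwnT ps → AllPairs RelT ps → All (Rich (E + r)) ps →
        ¬ ω (lv (E + r)) P → ¬ ω (uLev N K c r) U →
        (∀ x → P x → All (λ p → x ⟶ proj₁ p) ps) → (∀ u → U u → All (λ p → proj₁ p ⟶ u) ps) →
        (∀ x → P x → W₀ x) → (∀ x → U x → U₀ x) → All (λ p → ∀ x → proj₂ p x → W₀ x) ps → ⊥
      build zero ps P U l own rel rch _ _ _ _ _ _ _ =
        noTagged refl ps (trans (sym (+-identityʳ _)) l) own rel (subst (λ e → All (Rich e) ps) (+-identityʳ E) rch)
      build (suc r) ps P U l own rel rch nP nU P⟵ U⟵ P⊆ U⊆ ps⊆ =
        (do
          b₁ ← smallOut U u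
          b₂ ← fewSeeLittleOut {U = U} {W = P} t (λ cx cy p q → npWU cx cy (All.map (P⊆ _) p) (All.map (U⊆ _) q)) nP′
          b₃ ← fewSeeLittleIn {U = U} {W = P} t (λ cx cy p q → npUW cx cy (All.map (U⊆ _) p) (All.map (P⊆ _) q)) nP′
          b₄ ← ¬¬-All (All.zipWith (λ { (s , n) → fewSeeLittleOut {U = U} t
                  (λ cx cy p q → npWU cx cy (All.map (s _) p) (All.map (U⊆ _) q)) (large n ∘ ω-≤ (badLv (E + r))) })
                  (ps⊆ , rch′))
          pick nU (ω-∪ (λ _ _ → return) (ω-∪ (λ _ _ → return) b₁ (ω-∪ (λ _ _ → return) b₂ b₃))
                       (ω-≤ (*-monoˡ-≤ c (≤-trans (m≤m+n _ (suc r)) (≤-reflexive l))) (ω-list ps b₄))))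
        λ { (v , Xv , Uv , nb) → let v⟶ = U⟵ v Uv in
          build r ((v , λ x → P x × v ⟶ x) ∷ map (restrict (v ⟶_)) ps) (λ x → P x × x ⟶ v) (λ x → U x × v ⟶ x)
            (trans (cong (λ z → suc (z + r)) (length-map _ ps)) (trans (sym (+-suc _ r)) l))
            (ownT Xv (λ _ → proj₂) ∷ ⊴-own (restrict-⊴ _ ps) own)
            (AllP.map⁺ (All.tabulate λ p∈ → relT (All.lookup v⟶ p∈) (λ _ → proj₂) λ x q → All.lookup (P⟵ x (proj₁ q)) p∈)
              ∷ ⊴-rel (restrict-⊴ _ ps) rel)
            (rich (λ o → nb (inj₁ (inj₂ (inj₁ (Uv , o))))) ∷
             AllP.map⁺ (All.map (λ n → rich λ o → n (Uv , o)) (AllP.¬Any⇒All¬ ps (nb ∘ inj₂))))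
            (λ o → nb (inj₁ (inj₂ (inj₂ (Uv , o)))))
            (λ o → nb (inj₁ (inj₁ (Uv , o))))
            (λ { x (p , q) → q ∷ AllP.map⁺ (P⟵ x p) })
            (λ { x (p , q) → q ∷ AllP.map⁺ (U⟵ x p) })
            (λ x → P⊆ x ∘ proj₁) (λ x → U⊆ x ∘ proj₁)
            ((λ x → P⊆ x ∘ proj₁) ∷ AllP.map⁺ (All.map (λ s x → s x ∘ proj₁) ps⊆)) }
        where
        t = lv (E + r)
        u = uLev N K c r
        rch′ : All (Rich (suc (E + r))) ps
        rch′ = subst (λ e → All (Rich e) ps) (+-suc E r) rch
        nP′ : ¬ ω (c + ℓ * suc t) P
        nP′ o = nP (ω-≤ (≤-trans (badLv (E + r)) (≤-reflexive (cong lv (sym (+-suc E r))))) o)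

    R₀ : ℕ
    R₀ = lv (E + N) + uLev N K c N

    -- Between the two differences a pure pair in one direction closes a triangle with `y`, in the
    -- other direction with `y′`. Tagged sets can then be built from them.
    comparable : ∀ y y′ → X y → X y′ → ¬ ω R₀ (Df y y′) → ¬ ω R₀ (Df y′ y) → ⊥
    comparable y y′ Xy Xy′ n n′ = Alternating.build (Df y y′) (Df y′ y)
      (λ cx cy p q r → noTriangle y Xy cx cy (All.map proj₁ p) (All.map proj₂ q) r)
      (λ cx cy p q r → noTriangle y′ Xy′ cx cy (All.map proj₁ p) (All.map proj₂ q) r)
      N [] (Df y′ y) (Df y y′) refl [] [] []
      (n′ ∘ ω-≤ (m≤m+n _ _)) (n ∘ ω-≤ (m≤n+m _ _))
      (λ _ _ → []) (λ _ _ → []) (λ _ → id) (λ _ → id) []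

-- Sorting, and lists of blocks.

coreBound : ℕ → ℕ → ℕ → ℕ → ℕ
-- A block has clique number at most `r`, a back-clique meets at most `N` blocks of one parity, and
-- there are two parities.
coreBound ℓ c a b = N * r + N * r
  where
  N  = setCount a b
  K  = domBound ℓ c a
  R₀ = lev N ℓ c (cost a b + N) + uLev N K c N
  R₁ = suc (R₀ + R₀)
  gap = lev N ℓ c (cost a b) + suc N * suc R₁
  R₂ = suc (R₁ + suc (gap + R₁))
  r  = 1 + (K * suc R₂ + K * suc R₁)

¬¬-AllPairs : {R : A → A → Set ℓ₂} {xs : List A} → AllPairs (λ x y → ¬ ¬ R x y) xs → ¬ ¬ AllPairs R xs
¬¬-AllPairs []       = return []
¬¬-AllPairs (p ∷ ps) = ¬¬-All p >>= λ q → ¬¬-AllPairs ps >>= λ qs → return (q ∷ qs)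

insert : {R : A → A → Set ℓ₂} → (∀ {x y z} → R x y → R y z → R x z) → (∀ {x} → ¬ R x x) →
  ∀ y (L : List A) → AllPairs (λ u v → ¬ R v u) L →
  ¬ ¬ (∃ λ L′ → AllPairs (λ u v → ¬ R v u) L′ × (∀ v → v ∈ y ∷ L → v ∈ L′) × (∀ v → v ∈ L′ → v ∈ y ∷ L))
insert tr ir y [] [] = return (y ∷ [] , [] ∷ [] , (λ _ → id) , λ _ → id)
insert {R = R} tr ir y (z ∷ L) (p ∷ ps) = em-case
  (λ (y<z : R y z) → return (y ∷ z ∷ L ,
     ((λ z<y → ir (tr y<z z<y)) ∷ All.map (λ n l<y → n (tr l<y y<z)) p) ∷ p ∷ ps , (λ _ → id) , λ _ → id))
  (λ ¬y<z → insert tr ir y L ps >>= λ { (L′ , s , f , g) → return (z ∷ L′ ,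
     All.tabulate (λ m → All.lookup (¬y<z ∷ p) (g _ m)) ∷ s ,
     (λ { v (here e) → there (f v (here e)) ; v (there (here e)) → here e ; v (there (there m)) → there (f v (there m)) }) ,
     (λ { v (here e) → there (here e) ; v (there m) → swap (g v m) })) })
  where
  swap : ∀ {v : A} {L : List A} {y z : A} → v ∈ y ∷ L → v ∈ y ∷ z ∷ L
  swap (here e)  = here e
  swap (there m) = there (there m)

-- A linear extension by insertion. The relation is neither total nor decidable, which is why the
-- conclusion is only that no later entry precedes an earlier one.
sort : {R : A → A → Set ℓ₂} → (∀ {x y z} → R x y → R y z → R x z) → (∀ {x} → ¬ R x x) → (L : List A) →
  ¬ ¬ (∃ λ L′ → AllPairs (λ u v → ¬ R v u) L′ × (∀ v → v ∈ L → v ∈ L′) × (∀ v → v ∈ L′ → v ∈ L))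
sort tr ir [] = return ([] , [] , (λ _ → id) , λ _ → id)
sort {R = R} tr ir (x ∷ L) = sort tr ir L >>= λ { (L₁ , s₁ , f₁ , g₁) →
  insert {R = R} tr ir x L₁ s₁ >>= λ { (L₂ , s₂ , f₂ , g₂) → return (L₂ , s₂ ,
    (λ { v (here e) → f₂ v (here e) ; v (there m) → f₂ v (there (f₁ v m)) }) ,
    (λ v m → case g₂ v m of λ { (here e) → here e ; (there m′) → there (g₁ v m′) })) } }

odds : List A → List A
odds []           = []
odds (x ∷ [])     = x ∷ []
odds (x ∷ _ ∷ xs) = x ∷ odds xs

odds⊆ : ∀ (xs : List A) {x} → x ∈ odds xs → x ∈ xs
odds⊆ (x ∷ [])     m         = m
odds⊆ (x ∷ y ∷ xs) (here e)  = here e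
odds⊆ (x ∷ y ∷ xs) (there m) = there (there (odds⊆ xs m))

evens : List A → List A
evens []       = []
evens (_ ∷ xs) = odds xs

evens⊆ : ∀ (xs : List A) {x} → x ∈ evens xs → x ∈ xs
evens⊆ (x ∷ xs) m = there (odds⊆ xs m)

odds⊎evens : ∀ (xs : List A) {x} → x ∈ xs → x ∈ odds xs ⊎ x ∈ evens xs
odds⊎evens (x ∷ [])     m                 = inj₁ m
odds⊎evens (x ∷ y ∷ xs) (here e)          = inj₁ (here e)
odds⊎evens (x ∷ y ∷ xs) (there m) with odds⊎evens (y ∷ xs) m
... | inj₁ q = inj₂ q
... | inj₂ q = inj₁ (there q)

-- A partial transversal: at most one entry from each list, in the order of the lists.
data Trans {A : Set} : List A → List (List A) → Set where
  []   : Trans [] []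
  skip : ∀ {t B Bs} → Trans t Bs → Trans t (B ∷ Bs)
  _∷_  : ∀ {v t B Bs} → v ∈ B → Trans t Bs → Trans (v ∷ t) (B ∷ Bs)

Trans-All : ∀ {A : Set} {P : A → Set} {t Bs} → Trans t Bs → All (All P) Bs → All P t
Trans-All []       []       = []
Trans-All (skip t) (_ ∷ ps) = Trans-All t ps
Trans-All (m ∷ t)  (p ∷ ps) = All.lookup p m ∷ Trans-All t ps

Trans-AllPairs : ∀ {A : Set} {R : A → A → Set} {t Bs} → Trans t Bs →
  AllPairs (λ B B′ → All (λ v → All (R v) B′) B) Bs → AllPairs R t
Trans-AllPairs []       []       = []
Trans-AllPairs (skip t) (_ ∷ ps) = Trans-AllPairs t ps
Trans-AllPairs (m ∷ t)  (p ∷ ps) = Trans-All t (All.map (λ q → All.lookup q m) p) ∷ Trans-AllPairs t ps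

-- The order along nearly nested out-neighbourhoods.

module Final (𝕋 : Tourn) (𝔸 : Core.AmbientData 𝕋) where
  open Tourn 𝕋
  open Tour 𝕋
  open Core 𝕋
  open AmbientData 𝔸
  open Ambient 𝔸
  open Tagged N

  R₁ : ℕ
  R₁ = suc (R₀ + R₀)

  -- x precedes y when the out-neighbourhood of x is much larger.
  data _≺_ : V → V → Set where
    [_] : ∀ {x y} → X x × X y × ¬ ω R₁ (Df x y) → x ≺ y
    _∷_ : ∀ {x y z} → x ≺ y → X y × X z × ¬ ω R₁ (Df y z) → x ≺ z

  ≺-trans : ∀ {x y z} → x ≺ y → y ≺ z → x ≺ z
  ≺-trans p [ q ]   = p ∷ q
  ≺-trans p (q ∷ r) = ≺-trans p q ∷ r

  -- Induction along the chain. If `Df x z` were small, then, `Df y x` being small by `comparable`,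
  -- the triangle inequality would bound `Df y z` by `suc (R₀ + R₀)`, which is `R₁`.
  ≺⇒large : ∀ {x y} → x ≺ y → X x × ¬ ω R₀ (Df x y)
  ≺⇒large [ Xx , Xy , n ] = Xx , λ o → n (ω-≤ (≤-trans (m≤m+n R₀ R₀) (n≤1+n _)) o)
  ≺⇒large {x} (p ∷ (Xy , Xz , n)) = let (Xx , n′) = ≺⇒large p in
    Xx , λ o → comparable _ _ Xx Xy n′ λ o′ → n (Df-triangle Xx o′ o)

  ≺-irrefl : ∀ {x} → ¬ x ≺ x
  ≺-irrefl p = proj₂ (≺⇒large p) (Ω-∅ λ { _ (_ , q , r) → asym q r })

  Close : V → V → Set
  Close u v = ω R₁ (Df v u)

  -- Room to remove a single vertex and a difference of clique number at most `R₁`, up to `suc N`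
  -- times, and still exceed `lv E`.
  gap : ℕ
  gap = lv E + suc N * suc R₁

  record Ch (u z : V) : Set where
    constructor ch
    field
      back  : z ⟶ u
      close : ω R₁ (Df z u)
      far   : ¬ ω gap (Df u z)

  record TagList (s : ℕ) (v : V) (t : List V) : Set₁ where
    constructor tagList
    field
      ps   : List TS
      len  : length ps ≡ length t
      tag∈ : All (λ p → proj₁ p ∈ v ∷ t) ps
      own  : All OwnT ps
      rel  : AllPairs RelT ps
      lrg  : All (λ p → ¬ ω s (proj₂ p)) ps

  -- The set of `v` is `Df v w` without, for each later `z`, the vertex `z` and the small `Df z w`.
  -- Adding `v` costs every later set the vertex `v` and one small difference, so `s` grows in the
  -- recursion. The last vertex only delimits and gets no set.
  tagged : ∀ s v t → All X (v ∷ t) → AllPairs Ch (v ∷ t) → s + length t * suc R₁ ≤ gap → TagList s v t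
  tagged s v [] _ _ _ = tagList [] refl [] [] [] []
  tagged s v (w ∷ t) (Xv ∷ Xs) (p ∷ q@(pw ∷ _)) le
    with tagged (s + suc R₁) w t Xs q (≤-trans (≤-reflexive (+-assoc s (suc R₁) (length t * suc R₁))) le)
  ... | tagList ps len tag∈ own rel lrg = tagList
    ((v , W) ∷ map (restrict (v ⟶_)) ps) (cong suc (trans (length-map _ ps) len))
    (here refl ∷ AllP.map⁺ (All.map there tag∈))
    (ownT Xv (λ _ → proj₁) ∷ ⊴-own (restrict-⊴ _ ps) own)
    (AllP.map⁺ (All.map (λ m → relT (Ch.back (All.lookup p m)) (λ _ → proj₂) (λ x r → All.lookup (proj₂ r) m)) tag∈)
       ∷ ⊴-rel (restrict-⊴ _ ps) rel)
    (largeW ∷ AllP.map⁺ (All.zipWith (λ { (m , o , n) o′ → n (ω-∪ {Z = λ x → x ≡ v ⊎ Df _ v x}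
        (λ x _ y → return (cut (OwnT.tag⟶ o) x y)) o′
        (ω-∪ (λ _ _ → return) (ω-one v λ _ e → e) (Ch.close (All.lookup p m)))) })
      (tag∈ , All.zip (own , lrg))))
    where
    W : V → Set
    W x = v ⟶ x × All (x ⟶_) (w ∷ t)
    cut : ∀ {k : TS} → (∀ x → proj₂ k x → proj₁ k ⟶ x) → ∀ x → proj₂ k x →
      (proj₂ k x × v ⟶ x) ⊎ (x ≡ v ⊎ Df (proj₁ k) v x)
    cut o x y with tri x v
    ... | inj₁ e        = inj₂ (inj₁ e)
    ... | inj₂ (inj₁ r) = inj₂ (inj₂ (o x y , r))
    ... | inj₂ (inj₂ r) = inj₁ (y , r)
    cutAll : ∀ x t → x ⟶ w → All (x ⟶_) t ⊎ Any (λ z → x ≡ z ⊎ Df z w x) t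
    cutAll x [] _ = inj₁ []
    cutAll x (z ∷ t) a with tri x z
    ... | inj₁ e        = inj₂ (here (inj₁ e))
    ... | inj₂ (inj₁ r) = Sum.map (r ∷_) there (cutAll x t a)
    ... | inj₂ (inj₂ r) = inj₂ (here (inj₂ (r , a)))
    largeW : ¬ ω s W
    largeW o = Ch.far (All.head p) (ω-≤ (≤-trans (+-monoʳ-≤ s (m≤n+m (length t * suc R₁) (suc R₁))) le)
      (ω-∪ (λ { x _ (a , b) → return (Sum.map (λ c → a , b ∷ c) id (cutAll x t b)) }) o
        (ω-list t (All.map (λ {z} c → ω-∪ (λ _ _ → return) (ω-one z λ _ e → e) (Ch.close c)) pw))))

  noLong : ∀ t → All X t → AllPairs Ch t → length t ≤ N
  -- A chain of `suc N` vertices yields `N` tagged sets.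
  noLong t Xs p = ≮⇒≥ λ lt → go (take (suc N) t) (AllP.take⁺ (suc N) Xs) (AllPairsP.take⁺ (suc N) p)
      (trans (length-take (suc N) t) (m≤n⇒m⊓n≡m lt))
    where
    go : ∀ t → All X t → AllPairs Ch t → length t ≡ suc N → ⊥
    go (v ∷ t) Xs p l with suc-injective l
    ... | l′ with tagged (lv E) v t Xs p (+-monoʳ-≤ (lv E) (*-monoˡ-≤ (suc R₁) (≤-trans (≤-reflexive l′) (n≤1+n N))))
    ... | tagList ps len _ own rel lrg = noTagged refl ps (trans len l′) own rel (All.map rich lrg)

  R₂ : ℕ
  R₂ = suc (R₁ + suc (gap + R₁))

  Block : Set
  Block = V × List V

  blk : Block → List V
  blk (u , P) = u ∷ P

  flat : List Block → List V
  flat []       = []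
  flat (b ∷ bs) = blk b ++ flat bs

  Far : Block → Block → Set
  Far b b′ = ¬ ω R₂ (Df (proj₁ b) (proj₁ b′))

  Tight : Block → Set
  Tight (u , P) = All (λ v → ω R₂ (Df u v)) P

  -- Greedily, a vertex too far from the current leader opens a new block.
  blocks : ∀ u L → ¬ ¬ (∃₂ λ P bs → L ≡ P ++ flat bs × All Tight ((u , P) ∷ bs) × Linked Far ((u , P) ∷ bs))
  blocks u [] = return ([] , [] , refl , [] ∷ [] , [-])
  blocks u (x ∷ L) = em-case
    (λ o → blocks u L >>= λ { (P , bs , e , t ∷ ts , l) → return (x ∷ P , bs , cong (x ∷_) e , (o ∷ t) ∷ ts , relink l) })
    (λ n → blocks x L >>= λ { (P , bs , e , ts , l) → return ([] , (x , P) ∷ bs , cong (x ∷_) e , [] ∷ ts , n ∷ l) })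
    where
    relink : ∀ {P P′ bs} → Linked Far ((u , P) ∷ bs) → Linked Far ((u , P′) ∷ bs)
    relink [-]     = [-]
    relink (f ∷ l) = f ∷ l

  ∈-flat : ∀ {b bs v} → b ∈ bs → v ∈ blk b → v ∈ flat bs
  ∈-flat (here refl)           m = ∈-++⁺ˡ m
  ∈-flat {bs = b ∷ bs} (there b∈) m = ∈-++⁺ʳ (blk b) (∈-flat b∈ m)

  ∈-flat⁻ : ∀ {v} bs → v ∈ flat bs → ∃ λ b → b ∈ bs × v ∈ blk b
  ∈-flat⁻ (b ∷ bs) m with ∈-++⁻ (blk b) m
  ... | inj₁ p = b , here refl , p
  ... | inj₂ p = let (b′ , q , r) = ∈-flat⁻ bs p in b′ , there q , r

  Sp : V → V → Set
  Sp v w = ω R₁ (Df w v) × ¬ ω gap (Df v w)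

  -- Were `Df v w` small, two triangle inequalities through `v` and `w` would bring the leaders of
  -- `b′` and `b″` within `R₂`. So any two kept blocks need a skipped block between them.
  spaced : ∀ bs → All X (flat bs) → AllPairs Close (flat bs) → Linked Far bs →
    AllPairs (λ b b′ → All (λ v → All (Sp v) (blk b′)) (blk b)) (odds bs)
  spaced []           _ _ _ = []
  spaced (b ∷ [])     _ _ _ = [] ∷ []
  spaced (b ∷ b′ ∷ []) _ _ _ = [] ∷ []
  spaced (b ∷ b′ ∷ b″ ∷ bs) Xs cl (_ ∷ f ∷ fs) with AllPairs-++⁻ (blk b) cl
  ... | _ , cl₁ , x₁ with AllPairs-++⁻ (blk b′) cl₁
  ... | _ , cl₂ , x₂ =
    All.tabulate (λ c∈ → All.tabulate λ v∈ → All.tabulate λ w∈ → sp v∈ (∈-flat (odds⊆ (b″ ∷ bs) c∈) w∈))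
    ∷ spaced (b″ ∷ bs) (AllP.++⁻ʳ (blk b′) (AllP.++⁻ʳ (blk b) Xs)) cl₂ fs
    where
    sp : ∀ {v w} → v ∈ blk b → w ∈ flat (b″ ∷ bs) → Sp v w
    sp {v} {w} v∈ w∈ = All.lookup (AllP.++⁻ʳ (blk b′) (All.lookup x₁ v∈)) w∈ , λ o →
      f (Df-triangle (All.lookup Xs (∈-++⁺ˡ v∈)) (All.head (All.lookup x₁ v∈))
          (Df-triangle (All.lookup Xs (∈-++⁺ʳ (blk b) (∈-++⁺ʳ (blk b′) w∈))) o (end w∈)))
      where
      end : w ∈ flat (b″ ∷ bs) → ω R₁ (Df w (proj₁ b″))
      end (here refl) = Ω-∅ λ { _ (_ , q , r) → asym q r }
      end (there m)   = All.lookup (AllPairs.head cl₂) m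

  r : ℕ
  r = 1 + (K * suc R₂ + K * suc R₁)

  -- Split by the leader `u`. Among the vertices that `u` beats, the in-neighbours of `v` lie in
  -- `Df u v`, small by tightness; among those beating `u`, the out-neighbours of `v` lie in
  -- `Df v u`, small by closeness.
  blockΩ : ∀ b → Tight b → All X (blk b) → AllPairs Close (blk b) → ¬ ¬ Ω r (_∈ blk b)
  blockΩ (u , P) ti Xs (cl ∷ _) =
    smallIn (λ v → v ∈ P × u ⟶ v) R₂ >>= λ o₁ →
    smallOut (λ v → v ∈ P × v ⟶ u) R₁ >>= λ o₂ →
    return (Ω-mono (λ v m → All.lookup Xs m , m)
      (ω-∪ {Y = _≡ u} (λ v _ m → return (split v m)) (ω-one u λ _ e → e)
        (ω-∪ (λ _ _ → return)
          (ω-mono (λ v _ p → p , ω-mono (λ y _ q → proj₂ (proj₁ q) , proj₂ q) (All.lookup ti (proj₁ p))) o₁)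
          (ω-mono (λ v _ p → p , ω-mono (λ y _ q → proj₂ q , proj₂ (proj₁ q)) (All.lookup cl (proj₁ p))) o₂))))
    where
    split : ∀ v → v ∈ u ∷ P → v ≡ u ⊎ ((v ∈ P × u ⟶ v) ⊎ (v ∈ P × v ⟶ u))
    split v (here e) = inj₁ e
    split v (there m) with tri v u
    ... | inj₁ e        = inj₁ e
    ... | inj₂ (inj₁ q) = inj₂ (inj₂ (m , q))
    ... | inj₂ (inj₂ q) = inj₂ (inj₁ (m , q))

  -- Concatenate the orders. The first vertex of a back-clique in each block it meets stands for at
  -- most `k` vertices.
  glue : ∀ k Bs → All (λ B → Ω k (_∈ B)) Bs → ∃ λ L → (∀ v → v ∈ concat Bs → v ∈ L) ×
    (∀ K → K ⊑ L → AllPairs Back K → ∃ λ t → t ⊑ K × Trans t Bs × length K ≤ length t * k)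
  glue k [] [] = [] , (λ _ ()) , λ { [] [] _ → [] , [] , [] , z≤n }
  glue k (B ∷ Bs) (order L g c ∷ os) with glue k Bs os
  ... | L′ , c′ , tr = M ++ L′ ,
      (λ v m → case ∈-++⁻ B m of λ { (inj₁ p) → ∈-++⁺ˡ (∈-filter⁺ (_∈? B) (c v p) p) ; (inj₂ p) → ∈-++⁺ʳ M (c′ v p) }) ,
      go
    where
    -- An order may list vertices outside `B`, and these must not enter the transversal.
    M = filter (_∈? B) L
    go : ∀ K → K ⊑ M ++ L′ → AllPairs Back K → ∃ λ t → t ⊑ K × Trans t (B ∷ Bs) × length K ≤ length t * k
    go K s ap with ⊑-++⁻ M s
    ... | us , vs , refl , s₁ , s₂ with AllPairs-++⁻ us ap
    ... | ap₁ , ap₂ , _ with tr vs s₂ ap₂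
    ... | t , ts , τ , le with us
    ... | []      = t , ts , skip τ , le
    ... | u ∷ us′ = u ∷ t , refl ∷ Sub.++⁺ˡ us′ ts , All.head (All-resp-⊑ s₁ (AllP.all-filter (_∈? B) L)) ∷ τ ,
        ≤-trans (≤-reflexive (length-++ (u ∷ us′)))
                (+-mono-≤ (g (u ∷ us′) (⊆-trans s₁ (Sub.filter-⊆ (_∈? B) L)) ap₁) le)

  halfΩ : ∀ (cs : List Block) → All (All X) (map blk cs) →
    AllPairs (λ b b′ → All (λ v → All (Sp v) (blk b′)) (blk b)) cs →
    All (λ b → Ω r (_∈ blk b)) cs → Ω (N * r) (_∈ concat (map blk cs))
  halfΩ cs Xs sp os with glue r (map blk cs) (AllP.map⁺ os)
  ... | L , c , tr = order L
    (λ K s ap → case tr K s ap of λ { (t , ts , τ , le) → ≤-trans le (*-monoˡ-≤ r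
      (noLong t (Trans-All τ Xs) (AllPairs.zipWith (λ { (p , q , n) → ch p q n })
        (AllPairs-resp-⊑ ts ap , Trans-AllPairs τ (AllPairsP.map⁺ sp))))) }) c

  bounded : ¬ ¬ Ω (coreBound ℓ c a b) X
  bounded = filter-∈ {P = X} allV >>= λ { (ys , _ , Xys , cys) →
    sort ≺-trans ≺-irrefl ys >>= λ { (L , srt , f , g) →
    let XL = All.tabulate (λ m → All.lookup Xys (g _ m)) in
    ¬¬-AllPairs (close XL srt) >>= λ cl →
    fromSorted L XL cl >>= λ o → return (Ω-mono (λ v Xv → f v (cys v (complete v) Xv)) o) } }
    where
    close : ∀ {L} → All X L → AllPairs (λ u v → ¬ v ≺ u) L → AllPairs (λ u v → ¬ ¬ Close u v) L
    close []        []       = []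
    close (Xu ∷ Xs) (p ∷ ps) = All.zipWith (λ { (Xv , n) o → n [ Xv , Xu , o ] }) (Xs , p) ∷ close Xs ps
    fromSorted : ∀ L → All X L → AllPairs Close L → ¬ ¬ Ω (coreBound ℓ c a b) (_∈ L)
    fromSorted []      _  _  = return (Ω-∅ λ _ ())
    fromSorted (u ∷ L) Xs cl = blocks u L >>= λ { (P , bs , refl , ts , lk) → all ((u , P) ∷ bs) Xs cl ts lk }
      where
      inner : ∀ bs {b} → b ∈ bs → AllPairs Close (flat bs) → AllPairs Close (blk b)
      inner (b ∷ bs) (here refl) cl = proj₁ (AllPairs-++⁻ (blk b) cl)
      inner (b ∷ bs) (there m)   cl = inner bs m (proj₁ (proj₂ (AllPairs-++⁻ (blk b) cl)))
      all : ∀ bs → All X (flat bs) → AllPairs Close (flat bs) → All Tight bs → Linked Far bs →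
        ¬ ¬ Ω (coreBound ℓ c a b) (_∈ flat bs)
      all bs Xs cl ts lk =
        ¬¬-All (All.tabulate λ {b} b∈ → blockΩ b (All.lookup ts b∈) (Xb b∈) (inner bs b∈ cl)) >>= λ os →
        return (Ω-∪ (λ v m → return (side v m))
          (halfΩ (odds bs) (AllP.map⁺ (All.tabulate (Xb ∘ odds⊆ bs))) (spaced bs Xs cl lk) (All.tabulate (All.lookup os ∘ odds⊆ bs)))
          (halfΩ (evens bs) (AllP.map⁺ (All.tabulate (Xb ∘ evens⊆ bs))) (spacedEvens bs Xs cl lk) (All.tabulate (All.lookup os ∘ evens⊆ bs))))
        where
        Xb : ∀ {b} → b ∈ bs → All X (blk b)
        Xb b∈ = All.tabulate λ m → All.lookup Xs (∈-flat b∈ m)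
        spacedEvens : ∀ bs → All X (flat bs) → AllPairs Close (flat bs) → Linked Far bs →
          AllPairs (λ b b′ → All (λ v → All (Sp v) (blk b′)) (blk b)) (evens bs)
        spacedEvens []       _ _ _ = []
        spacedEvens (b ∷ bs) Xs cl lk = spaced bs (AllP.++⁻ʳ (blk b) Xs) (proj₁ (proj₂ (AllPairs-++⁻ (blk b) cl))) (Linked.tail lk)
        side : ∀ v → v ∈ flat bs → v ∈ concat (map blk (odds bs)) ⊎ v ∈ concat (map blk (evens bs))
        side v m = let (b , b∈ , m′) = ∈-flat⁻ bs m in
          Sum.map (λ q → ∈-concat⁺′ m′ (∈-map⁺ blk q)) (λ q → ∈-concat⁺′ m′ (∈-map⁺ blk q)) (odds⊎evens bs b∈)

-- Indexing lists, and the excluded tournaments.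

AllPairs-lookup : {R : A → A → Set ℓ₂} {xs : List A} → AllPairs R xs →
  ∀ i j → toℕ i < toℕ j → R (lookup xs i) (lookup xs j)
AllPairs-lookup (p ∷ ps) zero    (suc j) _  = All.lookup p (∈-lookup j)
AllPairs-lookup (p ∷ ps) (suc i) (suc j) lt = AllPairs-lookup ps i j (s≤s⁻¹ lt)

AllPairs-lookup⁻ : {R : A → A → Set ℓ₂} (xs : List A) →
  (∀ i j → toℕ i < toℕ j → R (lookup xs i) (lookup xs j)) → AllPairs R xs
AllPairs-lookup⁻ xs f = subst (AllPairs _) (tabulate-lookup xs) (AllPairsP.tabulate⁺-< λ {i} {j} → f i j)

AllPairs-All : {R : A → A → Set ℓ₂} {P : A → Set ℓ₃} {xs : List A} → AllPairs R xs → All P xs →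
  AllPairs (λ x y → P x × P y × R x y) xs
AllPairs-All []       []       = []
AllPairs-All (r ∷ rs) (p ∷ ps) = All.zipWith (λ { (q , s) → p , q , s }) (ps , r) ∷ AllPairs-All rs ps

≡ᵇ-refl : ∀ n → (n ≡ᵇ n) ≡ true
≡ᵇ-refl zero    = refl
≡ᵇ-refl (suc n) = ≡ᵇ-refl n

<ᵇ-true : ∀ {m n} → m < n → (m <ᵇ n) ≡ true
<ᵇ-true {zero}  {suc n} _  = refl
<ᵇ-true {suc m} {suc n} lt = <ᵇ-true {m} {n} (s≤s⁻¹ lt)

<ᵇ-true⁻ : ∀ {m n} → (m <ᵇ n) ≡ true → m < n
<ᵇ-true⁻ {zero}  {suc n} _ = s≤s z≤n
<ᵇ-true⁻ {suc m} {suc n} e = s≤s (<ᵇ-true⁻ {m} {n} e)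

≤ᵇ-true : ∀ {m n} → m ≤ n → (m ≤ᵇ n) ≡ true
≤ᵇ-true {zero}  _  = refl
≤ᵇ-true {suc m} lt = <ᵇ-true lt

≤ᵇ-true⁻ : ∀ {m n} → (m ≤ᵇ n) ≡ true → m ≤ n
≤ᵇ-true⁻ {zero}  _ = z≤n
≤ᵇ-true⁻ {suc m} e = <ᵇ-true⁻ {m} e

≢⇒≡ᵇ-false : ∀ {m n} → m ≢ n → (m ≡ᵇ n) ≡ false
≢⇒≡ᵇ-false {zero}  {zero}  n = ⊥-elim (n refl)
≢⇒≡ᵇ-false {zero}  {suc _} _ = refl
≢⇒≡ᵇ-false {suc _} {zero}  _ = refl
≢⇒≡ᵇ-false {suc m} {suc k} n = ≢⇒≡ᵇ-false {m} {k} (n ∘ cong suc)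

A-tri : ∀ k x y → x ≡ y ⊎ A-arc k x y ≡ true ⊎ A-arc k y x ≡ true
A-tri zero tt tt = inj₁ refl
A-tri (suc k) (inj₁ (i , x)) (inj₁ (j , y)) with <-cmp (toℕ i) (toℕ j)
... | tri< lt ne _ rewrite ≢⇒≡ᵇ-false ne = inj₂ (inj₁ (<ᵇ-true lt))
... | tri> _ ne gt rewrite ≢⇒≡ᵇ-false (ne ∘ sym) = inj₂ (inj₂ (<ᵇ-true gt))
... | tri≈ _ e _ with Fin.toℕ-injective e
... | refl rewrite ≡ᵇ-refl (toℕ i) = Sum.map₁ (cong (λ z → inj₁ (i , z))) (A-tri k x y)
A-tri (suc k) (inj₁ (j , _)) (inj₂ i) with ≤-<-connex (toℕ i) (toℕ j)
... | inj₁ le = inj₂ (inj₂ (≤ᵇ-true le))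
... | inj₂ lt = inj₂ (inj₁ (<ᵇ-true lt))
A-tri (suc k) (inj₂ i) (inj₁ (j , _)) with ≤-<-connex (toℕ i) (toℕ j)
... | inj₁ le = inj₂ (inj₁ (≤ᵇ-true le))
... | inj₂ lt = inj₂ (inj₂ (<ᵇ-true lt))
A-tri (suc k) (inj₂ i) (inj₂ j) with <-cmp (toℕ i) (toℕ j)
... | tri< lt _ _ = inj₂ (inj₂ (<ᵇ-true lt))
... | tri> _ _ gt = inj₂ (inj₁ (<ᵇ-true gt))
... | tri≈ _ e _  = inj₁ (cong inj₂ (Fin.toℕ-injective e))

D-tri : ∀ k x y → x ≡ y ⊎ D-arc k x y ≡ true ⊎ D-arc k y x ≡ true
D-tri zero tt tt = inj₁ refl
D-tri (suc k) (inj₁ (false , x)) (inj₁ (false , y)) = Sum.map₁ (cong (λ z → inj₁ (false , z))) (D-tri k x y)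
D-tri (suc k) (inj₁ (true  , x)) (inj₁ (true  , y)) = Sum.map₁ (cong (λ z → inj₁ (true , z))) (D-tri k x y)
D-tri (suc k) (inj₁ (false , x)) (inj₁ (true  , y)) = inj₂ (inj₁ refl)
D-tri (suc k) (inj₁ (true  , x)) (inj₁ (false , y)) = inj₂ (inj₂ refl)
D-tri (suc k) (inj₁ (true  , x)) (inj₂ tt) = inj₂ (inj₁ refl)
D-tri (suc k) (inj₁ (false , x)) (inj₂ tt) = inj₂ (inj₂ refl)
D-tri (suc k) (inj₂ tt) (inj₁ (true  , x)) = inj₂ (inj₂ refl)
D-tri (suc k) (inj₂ tt) (inj₁ (false , x)) = inj₂ (inj₁ refl)
D-tri (suc k) (inj₂ tt) (inj₂ tt) = inj₁ refl

enumA : ∀ i → List (AV i)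
enumA zero    = tt ∷ []
enumA (suc i) = map inj₁ (cartesianProduct (allFin (suc i)) (enumA i)) ++ map inj₂ (allFin (suc (suc i)))

∈-enumA : ∀ i x → x ∈ enumA i
∈-enumA zero    tt             = here refl
∈-enumA (suc i) (inj₁ (k , x)) = ∈-++⁺ˡ (∈-map⁺ inj₁ (∈-cartesianProduct⁺ (∈-allFin k) (∈-enumA i x)))
∈-enumA (suc i) (inj₂ k)       = ∈-++⁺ʳ (map inj₁ (cartesianProduct (allFin (suc i)) (enumA i))) (∈-map⁺ inj₂ (∈-allFin k))

enumD : ∀ j → List (DV j)
enumD zero    = tt ∷ []
enumD (suc j) = map inj₁ (cartesianProduct (false ∷ true ∷ []) (enumD j)) ++ (inj₂ tt ∷ [])

∈-enumD : ∀ j x → x ∈ enumD j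
∈-enumD zero    tt = here refl
∈-enumD (suc j) (inj₁ (b , x)) = ∈-++⁺ˡ (∈-map⁺ inj₁ (∈-cartesianProduct⁺ (∈-Bool b) (∈-enumD j x)))
  where
  ∈-Bool : ∀ b → b ∈ false ∷ true ∷ []
  ∈-Bool false = here refl
  ∈-Bool true  = there (here refl)
∈-enumD (suc j) (inj₂ tt) = ∈-++⁺ʳ (map inj₁ (cartesianProduct (false ∷ true ∷ []) (enumD j))) (here refl)

pointD : ∀ j → DV j
pointD zero    = tt
pointD (suc j) = inj₂ tt

bound : ℕ → ℕ → ℕ
bound zero    _       = 0
bound (suc i) zero    = 0
bound (suc i) (suc j) =
  -- A certificate joins a copy of `AV i` and one of `DV j`; a set without certificates misses one
  -- of them. The excluded `AV (suc i)` has `suc (suc i)` vertices of the form `inj₂`.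
  coreBound (length (enumA i) + length (enumD j)) (bound i (suc j) + bound (suc i) j) (suc (suc i)) (suc j)

-- Certificates and the induction.

module Graph {m : ℕ} (T : FinTournament m) where

  asTourn : Tourn
  asTourn = record
    { V = Fin m
    ; _≟_ = Fin._≟_
    ; _⟶_ = λ u v → arc T u v ≡ true
    ; _⟶?_ = λ u v → arc T u v Bool.≟ true
    ; tri = tri′
    ; asym = λ {u} {v} → asym′ u v
    ; allV = allFin m
    ; complete = ∈-allFin }
    where
    tri′ : ∀ u v → u ≡ v ⊎ arc T u v ≡ true ⊎ arc T v u ≡ true
    tri′ u v with u Fin.≟ v
    ... | yes e = inj₁ e
    ... | no ne with arc T u v in eq | tourn T v u (ne ∘ sym)
    ... | true  | _ = inj₂ (inj₁ refl)
    ... | false | q = inj₂ (inj₂ q)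
    asym′ : ∀ u v → arc T u v ≡ true → arc T v u ≡ true → ⊥
    asym′ u v p q with u Fin.≟ v
    ... | yes refl = case trans (sym p) (irrefl T u) of λ ()
    ... | no ne    = case trans (sym p) (trans (tourn T u v ne) (cong not q)) of λ ()

  open Tourn asTourn public
  open Tour asTourn public
  open Core asTourn public

  Emb : {W : Set} → (W → W → Bool) → (V → Set) → Set
  Emb {W} h X = ∃ λ (f : W → V) → (∀ x → X (f x)) × (∀ x y → h x y ≡ true → f x ⟶ f y)

  Emb-mono : {W : Set} {h : W → W → Bool} {X Y : V → Set} → (∀ v → X v → Y v) → Emb h X → Emb h Y
  Emb-mono i (f , p , q) = f , (λ x → i _ (p x)) , q

  -- The pattern is itself a tournament, so preserving arcs forces injectivity and leaves no room
  -- for further arcs.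
  Emb⇒Contains : {W : Set} {h : W → W → Bool} {X : V → Set} →
    (∀ x y → x ≡ y ⊎ h x y ≡ true ⊎ h y x ≡ true) → Emb h X → Contains T h
  Emb⇒Contains {h = h} tr (f , _ , arcs) = f , inj , same
    where
    inj : Injective _≡_ _≡_ f
    inj {x} {y} e with tr x y
    ... | inj₁ p        = p
    ... | inj₂ (inj₁ p) = ⊥-elim (let a = subst (f x ⟶_) (sym e) (arcs x y p) in asym a a)
    ... | inj₂ (inj₂ p) = ⊥-elim (let a = subst (f y ⟶_) e (arcs y x p) in asym a a)
    same : ∀ x y → arc T (f x) (f y) ≡ h x y
    same x y with h x y in eq
    ... | true = arcs x y eq
    ... | false with arc T (f x) (f y) in eq′
    ... | false = refl
    ... | true with tr x y
    ... | inj₁ refl     = ⊥-elim (asym eq′ eq′)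
    ... | inj₂ (inj₁ p) = trans (sym p) eq
    ... | inj₂ (inj₂ p) = ⊥-elim (asym eq′ (arcs y x p))

  module Step (i j : ℕ) (X : V → Set) (noA : ¬ Emb (A-arc (suc i)) X) (noD : ¬ Emb (D-arc (suc j)) X) where

    ℓ : ℕ
    ℓ = length (enumA i) + length (enumD j)

    record Cert (xs : List V) : Set where
      constructor cert
      field
        inX  : All X xs
        hasA : Emb (A-arc i) (_∈ xs)
        hasD : Emb (D-arc j) (_∈ xs)
        len  : length xs ≤ ℓ

    noTriangle : ∀ w {xs ys} → X w → Cert xs → Cert ys → All (w ⟶_) xs → All (_⟶ w) ys → xs ⇒ ys → ⊥
    noTriangle w {xs} {ys} Xw cx cy p q r = noD (f , inX , arcs)
      where
      open Σ (Cert.hasD cx) renaming (proj₁ to f₁; proj₂ to g₁)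
      open Σ (Cert.hasD cy) renaming (proj₁ to f₂; proj₂ to g₂)
      f : DV (suc j) → V
      f (inj₁ (false , x)) = f₁ x
      f (inj₁ (true  , x)) = f₂ x
      f (inj₂ tt)          = w
      inX : ∀ x → X (f x)
      inX (inj₁ (false , x)) = All.lookup (Cert.inX cx) (proj₁ g₁ x)
      inX (inj₁ (true  , x)) = All.lookup (Cert.inX cy) (proj₁ g₂ x)
      inX (inj₂ tt)          = Xw
      arcs : ∀ x y → D-arc (suc j) x y ≡ true → f x ⟶ f y
      arcs (inj₁ (false , x)) (inj₁ (false , y)) e = proj₂ g₁ x y e
      arcs (inj₁ (true  , x)) (inj₁ (true  , y)) e = proj₂ g₂ x y e
      arcs (inj₁ (false , x)) (inj₁ (true  , y)) _ = All.lookup (All.lookup r (proj₁ g₁ x)) (proj₁ g₂ y)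
      arcs (inj₁ (true  , x)) (inj₂ tt)          _ = All.lookup q (proj₁ g₂ x)
      arcs (inj₂ tt)          (inj₁ (false , y)) _ = All.lookup p (proj₁ g₁ y)

    noAStr : (v : Fin (suc (suc i)) → V) (t : Fin (suc i) → List V) →
      (∀ k → X (v k)) → (∀ k → Cert (t k)) →
      (∀ k l → toℕ k < toℕ l → v l ⟶ v k) →
      (∀ k l → toℕ k < toℕ l → t k ⇒ t l) →
      (∀ k l → toℕ k ≤ toℕ l → All (v k ⟶_) (t l)) →
      (∀ k l → toℕ l < toℕ k → All (_⟶ v k) (t l)) → ⊥
    noAStr v t Xv ct vv tt′ vt tv = noA (f , inX , arcs)
      where
      g : ∀ k → AV i → V
      g k = proj₁ (Cert.hasA (ct k))
      g∈ : ∀ k x → g k x ∈ t k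
      g∈ k = proj₁ (proj₂ (Cert.hasA (ct k)))
      f : AV (suc i) → V
      f (inj₁ (k , x)) = g k x
      f (inj₂ k)       = v k
      inX : ∀ x → X (f x)
      inX (inj₁ (k , x)) = All.lookup (Cert.inX (ct k)) (g∈ k x)
      inX (inj₂ k)       = Xv k
      arcs : ∀ x y → A-arc (suc i) x y ≡ true → f x ⟶ f y
      arcs (inj₁ (k , x)) (inj₁ (l , y)) e with <-cmp (toℕ k) (toℕ l)
      ... | tri< lt _ _ = All.lookup (All.lookup (tt′ k l lt) (g∈ k x)) (g∈ l y)
      ... | tri> ¬lt ne _ rewrite ≢⇒≡ᵇ-false ne = ⊥-elim (¬lt (<ᵇ-true⁻ e))
      ... | tri≈ _ eq _ with Fin.toℕ-injective eq
      ... | refl rewrite ≡ᵇ-refl (toℕ k) = proj₂ (proj₂ (Cert.hasA (ct k))) x y e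
      arcs (inj₂ k) (inj₂ l) e = vv l k (<ᵇ-true⁻ e)
      arcs (inj₂ k) (inj₁ (l , x)) e = All.lookup (vt k l (≤ᵇ-true⁻ e)) (g∈ l x)
      arcs (inj₁ (l , x)) (inj₂ k) e = All.lookup (tv k l (<ᵇ-true⁻ e)) (g∈ l x)

    record Seq (R : Pair → Pair → Set) (P : Pair → Set) (n : ℕ) : Set where
      constructor mkSeq
      field
        at  : Fin n → Pair
        rel : ∀ k l → toℕ k < toℕ l → R (at k) (at l)
        own : ∀ k → P (at k)

    toSeq : ∀ {R P n} ps → All P ps → AllPairs R ps → length ps ≡ n → Seq R P n
    toSeq ps own rel refl = mkSeq (lookup ps) (AllPairs-lookup rel) λ k → All.lookup own (∈-lookup k)

    -- The pattern has one copy fewer than it has vertices `v`, so the certificate of the last pair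
    -- is dropped.
    noChain : ∀ ps → All (λ p → X (proj₁ p) × Cert (proj₂ p) × All (proj₁ p ⟶_) (proj₂ p)) ps →
      AllPairs Full ps → length ps ≡ suc (suc i) → ⊥
    noChain ps own′ rel′ l = noAStr (proj₁ ∘ at) (proj₂ ∘ at ∘ inject₁)
        (proj₁ ∘ own) (proj₁ ∘ proj₂ ∘ own ∘ inject₁)
        (λ k l lt → proj₁ (rel k l lt))
        (λ k l lt → proj₂ (proj₂ (proj₂ (rel (inject₁ k) (inject₁ l)
           (subst₂ _<_ (sym (Fin.toℕ-inject₁ k)) (sym (Fin.toℕ-inject₁ l)) lt)))))
        vt
        (λ k l lt → proj₁ (proj₂ (proj₂ (rel (inject₁ l) k (subst (_< toℕ k) (sym (Fin.toℕ-inject₁ l)) lt)))))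
      where
      open Seq (toSeq ps own′ rel′ l)
      vt : ∀ k l → toℕ k ≤ toℕ l → All (proj₁ (at k) ⟶_) (proj₂ (at (inject₁ l)))
      vt k l le with m≤n⇒m<n∨m≡n le
      ... | inj₁ lt = proj₁ (proj₂ (rel k (inject₁ l) (subst (toℕ k <_) (sym (Fin.toℕ-inject₁ l)) lt)))
      ... | inj₂ e with Fin.toℕ-injective {i = k} {j = inject₁ l} (trans e (sym (Fin.toℕ-inject₁ l)))
      ... | refl = proj₂ (proj₂ (own (inject₁ l)))

    -- In the opposite tournament the pairs (v , X) are read from right to left, so that X
    -- belongs to the next vertex.
    noChainᵒᵖ : ∀ ps → All (λ p → X (proj₁ p) × Cert (proj₂ p) × All (_⟶ proj₁ p) (proj₂ p)) ps →
      AllPairs Op.Full ps → length ps ≡ suc (suc i) → ⊥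
    noChainᵒᵖ ps own′ rel′ l = noAStr (proj₁ ∘ at ∘ opposite) (proj₂ ∘ at ∘ opposite ∘ suc)
        (proj₁ ∘ own ∘ opposite) (proj₁ ∘ proj₂ ∘ own ∘ opposite ∘ suc)
        (λ k l lt → proj₁ (rel (opposite l) (opposite k) (opp lt)))
        (λ k l lt → flip⇒ (proj₂ (proj₂ (proj₂ (rel (opposite (suc l)) (opposite (suc k)) (opp (s≤s lt)))))))
        (λ k l le → proj₁ (proj₂ (proj₂ (rel (opposite (suc l)) (opposite k) (opp (s≤s le))))))
        tv
      where
      open Seq (toSeq ps own′ rel′ l)
      opp : ∀ {n} {k l : Fin n} → toℕ k < toℕ l → toℕ (opposite l) < toℕ (opposite k)
      opp {n} {k} {l} lt rewrite Fin.opposite-prop k | Fin.opposite-prop l = ∸-monoʳ-< (s≤s lt) (Fin.toℕ<n l)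
      flip⇒ : ∀ {xs ys} → All (λ x → All (λ y → y ⟶ x) ys) xs → ys ⇒ xs
      flip⇒ p = All.tabulate λ y∈ → All.map (λ q → All.lookup q y∈) p
      tv : ∀ k l → toℕ l < toℕ k → All (_⟶ proj₁ (at (opposite k))) (proj₂ (at (opposite (suc l))))
      tv k l lt with m≤n⇒m<n∨m≡n lt
      ... | inj₁ lt′ = proj₁ (proj₂ (rel (opposite k) (opposite (suc l)) (opp lt′)))
      ... | inj₂ e with Fin.toℕ-injective {i = suc l} {j = k} e
      ... | refl = proj₂ (proj₂ (own (opposite (suc l))))

  theorem : ∀ i j (X : V → Set) → ¬ Emb (A-arc i) X → ¬ Emb (D-arc j) X → ¬ ¬ Ω (bound i j) X
  theorem zero    j    X noA noD = return (Ω-∅ λ v x → noA ((λ _ → v) , (λ _ → x) , λ _ _ ()))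
  theorem (suc i) zero X noA noD = return (Ω-∅ λ v x → noD ((λ _ → v) , (λ _ → x) , λ _ _ ()))
  theorem (suc i) (suc j) X noA noD = Final.bounded asTourn record
      { X = X ; Cert = Cert ; ℓ = ℓ ; c = bound i (suc j) + bound (suc i) j ; a = suc (suc i) ; b = suc j
      ; cert-len = Cert.len ; cert-ne = λ cx → _ , proj₁ (proj₂ (Cert.hasD cx)) (pointD j)
      ; cert-free = cert-free
      ; noTriangle = noTriangle ; noChain = noChain ; noChainᵒᵖ = noChainᵒᵖ
      ; noD = λ f Xf arcs → noD (f , Xf , arcs) }
    where
    open Step i j X noA noD
    cert-free : ∀ (Y : V → Set) → ¬ (∃ λ xs → Cert xs × All Y xs) →
      ¬ ¬ Ω (bound i (suc j) + bound (suc i) j) (λ v → X v × Y v)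
    cert-free Y none = em-case
      (λ (a : Emb (A-arc i) (λ v → X v × Y v)) → em-case
        (λ (d : Emb (D-arc j) (λ v → X v × Y v)) → ⊥-elim (none (mk a d)))
        (λ ¬d → theorem (suc i) j _ (λ e → noA (Emb-mono {X = λ v → X v × Y v} {Y = X} (λ _ → proj₁) e)) ¬d >>= λ o →
                return (Ω-≤ (m≤n+m _ (bound i (suc j))) o)))
      (λ ¬a → theorem i (suc j) _ ¬a (λ e → noD (Emb-mono {X = λ v → X v × Y v} {Y = X} (λ _ → proj₁) e)) >>= λ o → return (Ω-≤ (m≤m+n _ _) o))
      where
      mk : Emb (A-arc i) (λ v → X v × Y v) → Emb (D-arc j) (λ v → X v × Y v) → ∃ λ xs → Cert xs × All Y xs
      mk (f , p , q) (f′ , p′ , q′) = xs ,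
          cert (All.map proj₁ XY)
               (f , (λ x → ∈-++⁺ˡ (∈-map⁺ f (∈-enumA i x))) , q)
               (f′ , (λ x → ∈-++⁺ʳ (map f (enumA i)) (∈-map⁺ f′ (∈-enumD j x))) , q′)
               (≤-reflexive (trans (length-++ (map f (enumA i))) (cong₂ _+_ (length-map f (enumA i)) (length-map f′ (enumD j))))) ,
          All.map proj₂ XY
        where
        xs = map f (enumA i) ++ map f′ (enumD j)
        XY : All (λ v → X v × Y v) xs
        XY = AllP.++⁺ (AllP.map⁺ {xs = enumA i} (All.tabulate λ {x} _ → p x)) (AllP.map⁺ {xs = enumD j} (All.tabulate λ {x} _ → p′ x))

  -- From a list to a permutation.

  Good? : ∀ k L → Dec (Good k L)
  Good? k       []      = yes λ { [] _ _ → z≤n }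
  Good? zero    (x ∷ L) = no λ g → case g (x ∷ []) (refl ∷ Sub.[]⊆-universal L) ([] ∷ []) of λ ()
  -- A back-clique either avoids `x` or continues among the back-neighbours of `x`.
  Good? (suc k) (x ∷ L) = map′ (λ { (g , h) → join g h }) (λ g → Good-filter g , Good-⊑ (x ∷ʳ ⊆-refl) g)
    (Good? k (filter (_⟶? x) L) ×-dec Good? (suc k) L)
    where
    sub : ∀ {K L} → K ⊑ L → All (_⟶ x) K → K ⊑ filter (_⟶? x) L
    sub {K} {L} s a = subst (_⊑ filter (_⟶? x) L) (filter-all (_⟶? x) a) (Sub.filter⁺ (_⟶? x) (_⟶? x) (λ { refl → id }) s)
    join : Good k (filter (_⟶? x) L) → Good (suc k) L → Good (suc k) (x ∷ L)
    join g h K       (.x ∷ʳ s)  ap       = h K s ap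
    join g h (_ ∷ K) (refl ∷ s) (p ∷ ap) = s≤s (g K (sub s p) ap)

  IsOrder : ℕ → List V → Set
  IsOrder c L = Good c L × AllPairs _≢_ L × (∀ v → v ∈ L)

  search : ∀ n {Q : List V → Set} → (∀ L → Dec (Q L)) → Dec (∃ λ L → length L ≡ n × Q L)
  search zero    Q? = map′ (λ q → [] , refl , q) (λ { ([] , _ , q) → q }) (Q? [])
  search (suc n) Q? = map′ (λ { (x , L , e , q) → x ∷ L , cong suc e , q })
    (λ { (x ∷ L , e , q) → x , L , suc-injective e , q }) (Fin.any? λ x → search n λ L → Q? (x ∷ L))

  dedup : (L : List V) → ∃ λ L′ → L′ ⊑ L × AllPairs _≢_ L′ × (∀ v → v ∈ L → v ∈ L′)
  dedup [] = [] , [] , [] , λ _ ()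
  dedup (x ∷ L) with dedup L
  ... | L′ , s , u , c with x ∈? L′
  ... | yes m = L′ , x ∷ʳ s , u , λ { v (here refl) → m ; v (there q) → c v q }
  ... | no ¬m = x ∷ L′ , refl ∷ s , All.tabulate (λ { m refl → ¬m m }) ∷ u ,
                λ { v (here e) → here e ; v (there q) → there (c v q) }

  module Perm (c : ℕ) (L : List V) (good : Good c L) (uniq : AllPairs _≢_ L) (cov : ∀ v → v ∈ L) where

    lookup-inj : ∀ i j → lookup L i ≡ lookup L j → i ≡ j
    lookup-inj i j e with <-cmp (toℕ i) (toℕ j)
    ... | tri< lt _ _ = ⊥-elim (AllPairs-lookup uniq i j lt e)
    ... | tri≈ _ q _  = Fin.toℕ-injective q
    ... | tri> _ _ gt = ⊥-elim (AllPairs-lookup uniq j i gt (sym e))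

    pos : V → Fin (length L)
    pos v = Any.index (cov v)

    lookup-pos : ∀ v → lookup L (pos v) ≡ v
    lookup-pos v = sym (AnyP.lookup-index (cov v))

    pos-lookup : ∀ i → pos (lookup L i) ≡ i
    pos-lookup i = lookup-inj _ i (lookup-pos (lookup L i))

    length≡m : length L ≡ m
    length≡m = ≤-antisym (Fin.injective⇒≤ {f = lookup L} λ {i} {j} → lookup-inj i j)
      (Fin.injective⇒≤ {f = pos} λ {u} {v} e → trans (sym (lookup-pos u)) (trans (cong (lookup L) e) (lookup-pos v)))

    π : Ordering m
    π = permutation (Fin.cast length≡m ∘ pos) (lookup L ∘ Fin.cast (sym length≡m))
      (λ i → trans (cong (Fin.cast length≡m) (pos-lookup _)) (trans (Fin.cast-trans (sym length≡m) length≡m i) (Fin.cast-is-id refl i)))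
      (λ v → trans (cong (lookup L) (trans (Fin.cast-trans length≡m (sym length≡m) (pos v)) (Fin.cast-is-id refl (pos v)))) (lookup-pos v))

    π-pos : ∀ {u v} → u ≺[ π ] v → toℕ (pos u) < toℕ (pos v)
    π-pos {u} {v} = subst₂ _<_ (Fin.toℕ-cast length≡m (pos u)) (Fin.toℕ-cast length≡m (pos v))

    ordered : AllPairs (λ u v → toℕ (pos u) < toℕ (pos v)) L
    ordered = AllPairs-lookup⁻ L λ i j lt → subst₂ (λ a b → toℕ a < toℕ b) (sym (pos-lookup i)) (sym (pos-lookup j)) lt

    -- Filtering `L` by the image of the clique lists its vertices by increasing position, as a
    -- sublist to which `good` applies.
    π-good : ωB≤ T π c
    π-good k (g , g-inj , edges) = ≤-trans
        (Fin.injective⇒≤ {f = λ i → Any.index (in-K i)} λ {i} {j} e → g-inj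
          (trans (AnyP.lookup-index (in-K i)) (trans (cong (lookup K) e) (sym (AnyP.lookup-index (in-K j))))))
        (good K (Sub.filter-⊆ inImage? L) (AllPairs.map back (AllPairs-All
          (AllPairs-resp-⊑ (Sub.filter-⊆ inImage? L) (AllPairs.zip (ordered , uniq))) (AllP.all-filter inImage? L))))
      where
      inImage? : ∀ v → Dec (∃ λ i → g i ≡ v)
      inImage? v = Fin.any? λ i → g i Fin.≟ v
      K = filter inImage? L
      in-K : ∀ i → g i ∈ K
      in-K i = ∈-filter⁺ inImage? (cov (g i)) (i , refl)
      back : ∀ {x y} → (∃ λ i → g i ≡ x) × (∃ λ i → g i ≡ y) × toℕ (pos x) < toℕ (pos y) × x ≢ y → y ⟶ x
      back ((i , refl) , (j , refl) , lt , ne) with edges i j (ne ∘ cong g)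
      ... | inj₁ (_ , a)  = a
      ... | inj₂ (gt , _) = ⊥-elim (<-asym lt (π-pos gt))

  -- Without repetitions a good order has length `m`, so its existence is decidable and the double
  -- negation can be removed.
  realise : ∀ c → ¬ ¬ Ω c (λ _ → ⊤) → cliqueNumber≤ T c
  realise c o = case decidable-stable (search m {IsOrder c} isOrder?) (o >>= return ∘ toOrder) of λ
      { (L , _ , g , u , cv) → Perm.π c L g u cv , Perm.π-good c L g u cv }
    where
    isOrder? : ∀ L → Dec (IsOrder c L)
    isOrder? L = Good? c L ×-dec (AllPairs.allPairs? (λ u v → ¬? (u Fin.≟ v)) L ×-dec Fin.all? λ v → v ∈? L)
    toOrder : Ω c (λ _ → ⊤) → ∃ λ L → length L ≡ m × IsOrder c L
    toOrder (order L g cv) with dedup L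
    ... | L′ , s , u , d = let g′ = Good-⊑ s g ; cv′ = λ v → d v (cv v tt) in
      L′ , Perm.length≡m c L′ g′ u cv′ , g′ , u , cv′

theorem2p1 : ∀ (k : ℕ) → ∃ λ (c : ℕ) →
    ∀ (m : ℕ) (T : FinTournament m) →
    ¬ Contains T (A-arc k) → ¬ Contains T (D-arc k) → cliqueNumber≤ T c
theorem2p1 k = bound k k , λ m T noA noD → let open Graph T in
  realise (bound k k) (theorem k k (λ _ → ⊤)
    (λ e → noA (Emb⇒Contains (A-tri k) e)) (λ e → noD (Emb⇒Contains (D-tri k) e)))
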